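{- Let $\mathcal{G}=(S,(P_\gamma)_{\gamma\in\Gamma})$ be a game frame whose state space $S$ is closed under the Souslin operation. Then $\mathfrak{I}_{\mathcal{G}}(\tau\mid A,q)\in\mathcal{B}(S)$ for all games $\tau$, all $A\in\mathcal{B}(S)$ and all $0\leq q\leq1$.
   Context: A measurable space $S$ has a $\sigma$-algebra $\mathcal{B}(S)$; $[0,1]$ carries its Borel sets; $S\otimes T$ is the product space. $\mathrm{Sub}(S)$ is the set of subprobability measures on $S$ with the smallest $\sigma$-algebra making all $\mu\mapsto\mu(A)$, $A\in\mathcal{B}(S)$, measurable. $\boldsymbol\beta(A,>q):=\{\mu\in\mathrm{Sub}(S)\mid\mu(A)>q\}$. $\mathcal{V}(S)$ is the set of all upward closed $V\subseteq\mathcal{B}(\mathrm{Sub}(S))$. A map $P:S\to\mathcal{V}(S)$ is t-measurable iff $\{\langle s,q\rangle\in S\times[0,1]\mid H_q\in P(s)\}\in\mathcal{B}(S\otimes[0,1])$ for every $H\in\mathcal{B}(\mathrm{Sub}(S)\otimes[0,1])$, where $H_q:=\{\mu\mid\langle\mu,q\rangle\in H\}$; a stochastic effectivity function on $S$ is a t-measurable map $S\to\mathcal{V}(S)$. Souslin operation: for a family $\{A_v\mid v\in\mathbb{N}^\star\}$ of sets indexed by finite words over $\mathbb{N}$, $\mathfrak{A}(\{A_v\}):=\bigcup_{\alpha\in\mathbb{N}^{\mathbb{N}}}\bigcap_{n\in\mathbb{N}}A_{\alpha|n}$, with $\alpha|n$ the word of the first $n$ letters of $\alpha$. $S$ is closed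 under the Souslin operation iff $\mathfrak{A}(\{A_v\})\in\mathcal{B}(S)$ whenever all $A_v\in\mathcal{B}(S)$. Games: $\Gamma$ is the set of primitive games, containing the empty game $\epsilon$. Games are given by $\tau::=\gamma\mid\tau^d\mid\tau_1\cup\tau_2\mid\tau_1\cap\tau_2\mid\tau_1;\tau_2\mid\tau^*\mid\tau^\times$ with $\gamma\in\Gamma$. Games are identified according to: $(\tau^d)^d=\tau$; $\tau_1\cap\tau_2=(\tau_1^d\cup\tau_2^d)^d$; $(\tau^\times)^d=(\tau^d)^*$; $(\tau_1\cup\tau_2);\tau=\tau_1;\tau\cup\tau_2;\tau$; $(\tau_1;\tau_2)^d=\tau_1^d;\tau_2^d$; $\cup,\cap$ are commutative and associative, and composition $;$ is associative; $\tau^*;\tau_0$ expands to $\tau_0\cup\tau;\tau_0\cup\tau;\tau;\tau_0\cup\dots$. A game frame $\mathcal{G}=(S,(P_\gamma)_{\gamma\in\Gamma})$ consists of a measurable space $S$ and a stochastic effectivity function $P_\gamma$ on $S$ for each $\gamma\in\Gamma$, with $P_\epsilon(s)=\{W\in\mathcal{B}(\mathrm{Sub}(S))\mid\delta_s\in W\}$ ($\delta_s$ the Dirac measure). Put $Q^{(k)}(q):=\{\langle a_1,\dots,a_k\rangle\in\mathbb{Q}^k\mid a_i\geq0,\ \sum_{i=1}^ka_i\leq q\}$ for $0\le k\leq\infty$. For $A\in\mathcal{B}(S)$ and real $q\geq0$ the set $\mathfrak{I}_{\mathcal{G}}(\tau\mid A,q)\subseteq S$ is defined recursively, modulo the identifications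 above, by (A) $\mathfrak{I}_{\mathcal{G}}(\gamma\mid A,q):=\{s\in S\mid\boldsymbol\beta(A,>q)\in P_\gamma(s)\}$ for $\gamma\in\Gamma$; (B) $\mathfrak{I}_{\mathcal{G}}(\tau^d\mid A,q):=S\setminus\mathfrak{I}_{\mathcal{G}}(\tau\mid S\setminus A,q)$; (C) $\mathfrak{I}_{\mathcal{G}}(\tau_1\cup\tau_2\mid A,q):=\bigcap_{a\in Q^{(2)}(q)}\bigl(\mathfrak{I}_{\mathcal{G}}(\tau_1\mid A,a_1)\cup\mathfrak{I}_{\mathcal{G}}(\tau_2\mid A,a_2)\bigr)$; (D) $\mathfrak{I}_{\mathcal{G}}((\tau_1\cup\tau_2);\tau\mid A,q):=\mathfrak{I}_{\mathcal{G}}(\tau_1;\tau\cup\tau_2;\tau\mid A,q)$; (E) $\mathfrak{I}_{\mathcal{G}}(\gamma;\tau\mid A,q):=\{s\in S\mid G_\tau(A,q)\in P_\gamma(s)\}$ for $\gamma\in\Gamma$, where $G_\tau(A,q):=\{\mu\in\mathrm{Sub}(S)\mid\int_0^1\mu(\mathfrak{I}_{\mathcal{G}}(\tau\mid A,r))\,dr>q\}$; (F) $\mathfrak{I}_{\mathcal{G}}(\tau^*;\tau_0\mid A,q):=\bigcap_{a\in Q^{(\infty)}(q)}\bigcup_{n\geq0}\mathfrak{I}_{\mathcal{G}}(\tau^n;\tau_0\mid A,a_{n+1})$, where $\tau^n=\tau;\dots;\tau$ ($n$ times) and $\tau^0;\tau_0=\tau_0$; a bare $\tau^*$ is read as $\tau^*;\epsilon$.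 -}

module Defs where

open import Algebra.Bundles using (CommutativeRing)
import Algebra.Definitions.RawMonoid as RawMonoidDefs
open import Axiom.ExcludedMiddle using (ExcludedMiddle)
open import Data.Bool.Base using (Bool; true; false; T; not; _∧_; _∨_; if_then_else_)
open import Data.Bool.Properties using (∨-comm; not-involutive)
open import Data.Empty using (⊥-elim)
open import Data.Fin.Base using (toℕ)
open import Data.Integer.Base as ℤ using (ℤ)
import Data.Integer.Properties as ℤ
open import Data.List.Base using (List; applyUpTo)
open import Data.Nat.Base as ℕ using (ℕ; zero; suc)
open import Data.Product.Base using (Σ; Σ-syntax; ∃; ∃-syntax; _×_; _,_; proj₁; proj₂)
open import Data.Rational.Base as ℚ using (ℚ; mkℚ; 0ℚ)
import Data.Rational.Properties as ℚ
import Data.Rational.Unnormalised.Base as ℚᵘ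
open import Data.Sum.Base using (inj₁; inj₂)
open import Data.Vec.Functional using (Vector)
open import Function.Base using (_∘_; id)
open import Function.Bundles using (_⇔_)
open import Level using (Level; _⊔_; 0ℓ) renaming (suc to lsuc)
open import Relation.Binary.Core using (Rel)
open import Relation.Binary.Structures using (IsTotalOrder)
import Relation.Binary.Construct.NonStrictToStrict as ToStrict
open import Relation.Binary.PropositionalEquality
  using (_≡_; _≢_; refl; sym; trans; cong; cong₂; subst)
open import Relation.Nullary using (¬_; yes; no; does)
open import Relation.Unary using (Pred)

-- ℝ is characterised, uniquely up to isomorphism, as the complete ordered
-- field.
record CompleteOrderedField : Set₁ where
  infix 4 _≤_
  field
    commutativeRing : CommutativeRing 0ℓ 0ℓ

  open CommutativeRing commutativeRing public
    hiding (refl; sym; trans; reflexive; setoid) renaming (Carrier to ℝ)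
  module Eq = CommutativeRing commutativeRing
    using (refl; sym; trans; reflexive; setoid)

  field
    _≤_          : Rel ℝ 0ℓ
    isTotalOrder : IsTotalOrder _≈_ _≤_
    +-monoˡ-≤    : ∀ z {x y} → x ≤ y → x + z ≤ y + z
    *-nonneg     : ∀ {x y} → 0# ≤ x → 0# ≤ y → 0# ≤ x * y
    0≉1          : ¬ (0# ≈ 1#)
    -- total, with an unspecified value at 0
    _⁻¹          : ℝ → ℝ
    *-inverseʳ   : ∀ {x} → ¬ (x ≈ 0#) → x * (x ⁻¹) ≈ 1#

  open ToStrict _≈_ _≤_ public using (_<_)

  IsUpperBound : ∀ {p} → Pred ℝ p → ℝ → Set p
  IsUpperBound P u = ∀ {x} → P x → x ≤ u

  IsSup : ∀ {p} → Pred ℝ p → ℝ → Set p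
  IsSup P u = IsUpperBound P u × (∀ v → IsUpperBound P v → u ≤ v)

  field
    complete : (P : Pred ℝ 0ℓ) → ∃ P → ∃ (IsUpperBound P) → ∃ (IsSup P)

  open RawMonoidDefs +-rawMonoid public using (sum) renaming (_×_ to _·_)

  fromℤ : ℤ → ℝ
  fromℤ (ℤ.+ n)      = n · 1#
  fromℤ (ℤ.-[1+ n ]) = - (suc n · 1#)

  fromℚ : ℚ → ℝ
  fromℚ p = fromℤ (ℚ.numerator p) * ((suc (ℚ.denominator-1 p) · 1#) ⁻¹)

  -- ∑ n a = a 0 + ... + a (n - 1)
  ∑ : ℕ → (ℕ → ℝ) → ℝ
  ∑ n a = sum {n} (a ∘ toℕ)

  -- The sum of a series of nonnegative terms, as supremum of the partial sums.
  IsSeriesSum : (ℕ → ℝ) → ℝ → Set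
  IsSeriesSum a = IsSup (λ x → ∃[ n ] x ≈ ∑ n a)

infix  9 _ᵈ _✶ _✕
infixr 7 _⨾_
infixr 6 _∩ᵍ_
infixr 5 _∪ᵍ_

data Game {g} (Γ : Set g) : Set g where
  prim : Γ → Game Γ
  _ᵈ   : Game Γ → Game Γ
  _∪ᵍ_ : Game Γ → Game Γ → Game Γ
  _∩ᵍ_ : Game Γ → Game Γ → Game Γ
  _⨾_  : Game Γ → Game Γ → Game Γ
  _✶   : Game Γ → Game Γ
  _✕   : Game Γ → Game Γ

-- The identifications of games.  The expansion of τ* ; τ₀ into an infinite
-- union is not a relation between games; it is the clause for τ* in _▷_ below.
infix 3 _∼_
data _∼_ {g} {Γ : Set g} : Game Γ → Game Γ → Set g where
  ∼-refl  : ∀ {τ} → τ ∼ τ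
  ∼-sym   : ∀ {τ τ′} → τ ∼ τ′ → τ′ ∼ τ
  ∼-trans : ∀ {τ τ′ τ″} → τ ∼ τ′ → τ′ ∼ τ″ → τ ∼ τ″
  ᵈ-cong  : ∀ {τ τ′} → τ ∼ τ′ → τ ᵈ ∼ τ′ ᵈ
  ∪-cong  : ∀ {σ σ′ τ τ′} → σ ∼ σ′ → τ ∼ τ′ → σ ∪ᵍ τ ∼ σ′ ∪ᵍ τ′
  ∩-cong  : ∀ {σ σ′ τ τ′} → σ ∼ σ′ → τ ∼ τ′ → σ ∩ᵍ τ ∼ σ′ ∩ᵍ τ′
  ⨾-cong  : ∀ {σ σ′ τ τ′} → σ ∼ σ′ → τ ∼ τ′ → σ ⨾ τ ∼ σ′ ⨾ τ′
  ✶-cong  : ∀ {τ τ′} → τ ∼ τ′ → τ ✶ ∼ τ′ ✶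
  ✕-cong  : ∀ {τ τ′} → τ ∼ τ′ → τ ✕ ∼ τ′ ✕
  ᵈ-invol : ∀ τ → (τ ᵈ) ᵈ ∼ τ
  ∩-dual  : ∀ σ τ → σ ∩ᵍ τ ∼ (σ ᵈ ∪ᵍ τ ᵈ) ᵈ
  ✕-dual  : ∀ τ → (τ ✕) ᵈ ∼ (τ ᵈ) ✶
  ⨾-distribʳ-∪ : ∀ ρ σ τ → (ρ ∪ᵍ σ) ⨾ τ ∼ (ρ ⨾ τ) ∪ᵍ (σ ⨾ τ)
  ⨾-dual  : ∀ σ τ → (σ ⨾ τ) ᵈ ∼ σ ᵈ ⨾ τ ᵈ
  ∪-comm  : ∀ σ τ → σ ∪ᵍ τ ∼ τ ∪ᵍ σ
  ∩-comm  : ∀ σ τ → σ ∩ᵍ τ ∼ τ ∩ᵍ σ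
  ∪-assoc : ∀ ρ σ τ → (ρ ∪ᵍ σ) ∪ᵍ τ ∼ ρ ∪ᵍ (σ ∪ᵍ τ)
  ∩-assoc : ∀ ρ σ τ → (ρ ∩ᵍ σ) ∩ᵍ τ ∼ ρ ∩ᵍ (σ ∩ᵍ τ)
  ⨾-assoc : ∀ ρ σ τ → (ρ ⨾ σ) ⨾ τ ∼ ρ ⨾ (σ ⨾ τ)

-- The mathematics is classical.  In the presence of excluded middle, Bool
-- classifies all propositions of all universes, so that X → Bool is the full
-- power set of X and comprehension is unrestricted; in particular the power
-- set stays in the universe of X, and can be iterated.
module Theory
  (em : {a : Level} → ExcludedMiddle a)
  (R : CompleteOrderedField)
  where

  open CompleteOrderedField R

  private
    variable
      a b ℓ ℓ′ p : Level

  infix  4 _∈_ _≐_ _⊆_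
  infixr 6 _∪_

  Pow : Set a → Set a
  Pow X = X → Bool

  _∈_ : {X : Set a} → X → Pow X → Set
  x ∈ A = T (A x)

  _⊆_ _≐_ : {X : Set a} → Pow X → Pow X → Set a
  A ⊆ B = ∀ x → x ∈ A → x ∈ B
  A ≐ B = ∀ x → A x ≡ B x

  -- comprehend P is the set { x ∣ P x }.
  comprehend : {X : Set a} → Pred X p → Pow X
  comprehend P x = does (em {P = P x})

  syntax comprehend (λ x → P) = ⟪ x ∣ P ⟫

  ∅ : {X : Set a} → Pow X
  ∅ _ = false

  ∁ : {X : Set a} → Pow X → Pow X
  ∁ A x = not (A x)

  _∪_ : {X : Set a} → Pow X → Pow X → Pow X
  (A ∪ B) x = A x ∨ B x

  ⋃ : {X : Set a} → (ℕ → Pow X) → Pow X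
  ⋃ A = ⟪ x ∣ (∃[ n ] x ∈ A n) ⟫

  Disjoint : {X : Set a} → (ℕ → Pow X) → Set a
  Disjoint A = ∀ m n → m ≢ n → ∀ x → x ∈ A m → ¬ (x ∈ A n)

  record MeasurableSpace ℓ : Set (lsuc ℓ) where
    field
      Point        : Set ℓ
      Measurable   : Pred (Pow Point) ℓ
      ≐-measurable : ∀ {A B} → A ≐ B → Measurable A → Measurable B
      ∅-measurable : Measurable ∅
      ∁-measurable : ∀ {A} → Measurable A → Measurable (∁ A)
      ⋃-measurable : ∀ {A} → (∀ n → Measurable (A n)) → Measurable (⋃ A)

    Event : Set ℓ
    Event = Σ (Pow Point) Measurable

  open MeasurableSpace public

  ∁ᴱ : {X : MeasurableSpace ℓ} → Event X → Event X
  ∁ᴱ {X = X} (A , m) = ∁ A , ∁-measurable X m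

  ⋃ᴱ : {X : MeasurableSpace ℓ} → (ℕ → Event X) → Event X
  ⋃ᴱ {X = X} A = ⋃ (proj₁ ∘ A) , ⋃-measurable X (proj₂ ∘ A)

  data Generated {X : Set ℓ} (𝒢 : Pred (Pow X) ℓ) : Pred (Pow X) ℓ where
    gen      : ∀ {A} → 𝒢 A → Generated 𝒢 A
    resp     : ∀ {A B} → A ≐ B → Generated 𝒢 A → Generated 𝒢 B
    empty    : Generated 𝒢 ∅
    compl    : ∀ {A} → Generated 𝒢 A → Generated 𝒢 (∁ A)
    countUni : ∀ {A} → (∀ n → Generated 𝒢 (A n)) → Generated 𝒢 (⋃ A)

  generatedBy : (X : Set ℓ) → Pred (Pow X) ℓ → MeasurableSpace ℓ
  generatedBy X 𝒢 = record
    { Point        = X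
    ; Measurable   = Generated 𝒢
    ; ≐-measurable = resp
    ; ∅-measurable = empty
    ; ∁-measurable = compl
    ; ⋃-measurable = countUni
    }

  _⊗_ : MeasurableSpace ℓ → MeasurableSpace ℓ′ → MeasurableSpace (ℓ ⊔ ℓ′)
  X ⊗ Y = generatedBy (Point X × Point Y) λ C →
    Σ[ A ∈ Event X ] Σ[ B ∈ Event Y ] C ≐ (λ (x , y) → proj₁ A x ∧ proj₁ B y)

  Interval : Set
  Interval = Σ[ x ∈ ℝ ] 0# ≤ x × x ≤ 1#

  Open : Pred (Pow Interval) 0ℓ
  Open U = ∀ x → x ∈ U → ∃[ ε ] 0# < ε ×
    (∀ y → proj₁ x - ε < proj₁ y → proj₁ y < proj₁ x + ε → y ∈ U)

  unitInterval : MeasurableSpace 0ℓ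
  unitInterval = generatedBy Interval Open

  MeasurableFn : (X : MeasurableSpace ℓ) → (Point X → ℝ) → Set ℓ
  MeasurableFn X f = ∀ c → Measurable X ⟪ x ∣ (c < f x) ⟫

  SouslinClosed : MeasurableSpace ℓ → Set ℓ
  SouslinClosed X = (A : List ℕ → Pow (Point X)) → (∀ v → Measurable X (A v)) →
    Measurable X ⟪ x ∣ (Σ[ α ∈ (ℕ → ℕ) ] ∀ n → x ∈ A (applyUpTo α n)) ⟫

  record SubProb (X : MeasurableSpace ℓ) : Set ℓ where
    field
      μ          : Event X → ℝ
      μ-cong     : ∀ A B → proj₁ A ≐ proj₁ B → μ A ≈ μ B
      μ-nonneg   : ∀ A → 0# ≤ μ A
      μ-empty    : μ (∅ , ∅-measurable X) ≈ 0#
      μ-additive : ∀ A → Disjoint (proj₁ ∘ A) → IsSeriesSum (μ ∘ A) (μ (⋃ᴱ {X = X} A))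
      μ-subprob  : ∀ A → μ A ≤ 1#

  open SubProb public using (μ)

  β : (X : MeasurableSpace ℓ) → Event X → ℝ → Pow (SubProb X)
  β X A q = ⟪ ν ∣ (q < μ ν A) ⟫

  -- The smallest σ-algebra making all evaluations ν ↦ ν(A) measurable: it is
  -- generated by the sets { ν ∣ ν(A) > q }, by definition of MeasurableFn.
  Sub : MeasurableSpace ℓ → MeasurableSpace ℓ
  Sub X = generatedBy (SubProb X) λ W → Σ[ A ∈ Event X ] ∃[ q ] W ≐ β X A q

  indicator : {X : Set a} → Pow X → X → ℝ
  indicator A x = if A x then 1# else 0#

  -- x is the ν-integral of some simple function Σᵢ cᵢ 1_{Eᵢ} ≤ f with cᵢ ≥ 0.
  SimpleIntegralBelow : (X : MeasurableSpace ℓ) → SubProb X → (Point X → ℝ) → Pred ℝ ℓ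
  SimpleIntegralBelow X ν f x =
    ∃[ k ] Σ[ c ∈ Vector ℝ k ] Σ[ E ∈ Vector (Event X) k ]
      (∀ i → 0# ≤ c i) ×
      (∀ t → sum (λ i → c i * indicator (proj₁ (E i)) t) ≤ f t) ×
      x ≈ sum (λ i → c i * μ ν (E i))

  -- f is measurable and x = ∫ f dν, for f ≥ 0.
  IsIntegral : (X : MeasurableSpace ℓ) → SubProb X → (Point X → ℝ) → ℝ → Set ℓ
  IsIntegral X ν f x = MeasurableFn X f × IsSup (SimpleIntegralBelow X ν f) x

  -- Lebesgue measure on [0,1] is the unique measure whose value on every
  -- closed interval is its length.
  IsLebesgue : SubProb unitInterval → Set
  IsLebesgue ν = ∀ {x y} → x ≤ y → 0# ≤ x → y ≤ 1# → (E : Event unitInterval) →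
    proj₁ E ≐ ⟪ t ∣ (x ≤ proj₁ t × proj₁ t ≤ y) ⟫ → μ ν E ≈ y - x

  module ≤ = IsTotalOrder isTotalOrder

  0≤1 : 0# ≤ 1#
  0≤1 with ≤.total 0# 1#
  ... | inj₁ 0≤1 = 0≤1
  ... | inj₂ 1≤0 = ⊥-elim (0≉1 (≤.antisym 0≤1′ 1≤0))
    where
    -1# : ℝ
    -1# = - 1#
    0≤-1 : 0# ≤ -1#
    0≤-1 = ≤.trans (≤.reflexive (Eq.sym (-‿inverseʳ 1#)))
             (≤.trans (+-monoˡ-≤ -1# 1≤0) (≤.reflexive (+-identityˡ -1#)))
    open import Algebra.Properties.Ring ring using (-‿distribˡ-*; -‿involutive)
    square : -1# * -1# ≈ 1#
    square = Eq.trans (Eq.sym (-‿distribˡ-* 1# -1#))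
               (Eq.trans (-‿cong (*-identityˡ -1#)) (-‿involutive 1#))
    0≤1′ : 0# ≤ 1#
    0≤1′ = ≤.trans (*-nonneg 0≤-1 0≤-1) (≤.reflexive square)

  does-cong : ∀ {p q} {P : Set p} {Q : Set q} → (P → Q) → (Q → P) → does (em {P = P}) ≡ does (em {P = Q})
  does-cong {P = P} {Q} f g with em {P = P} | em {P = Q}
  ... | yes _ | yes _ = refl
  ... | no _  | no _  = refl
  ... | yes p | no ¬q = ⊥-elim (¬q (f p))
  ... | no ¬p | yes q = ⊥-elim (¬p (g q))

  T-em : ∀ {p} {P : Set p} → P → T (does (em {P = P}))
  T-em {P = P} h with em {P = P}
  ... | yes _ = _
  ... | no ¬h = ¬h h

  em-T : ∀ {p} {P : Set p} → T (does (em {P = P})) → P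
  em-T {P = P} t with em {P = P}
  ... | yes h = h

  bool-ext : ∀ {x y} → (T x → T y) → (T y → T x) → x ≡ y
  bool-ext {false} {false} f g = refl
  bool-ext {true}  {true}  f g = refl
  bool-ext {false} {true}  f g = ⊥-elim (g _)
  bool-ext {true}  {false} f g = ⊥-elim (f _)

  private
    T⇒≡ : ∀ {x} → T x → x ≡ true
    T⇒≡ {true} _ = refl

    ¬T⇒≡ : ∀ {x} → ¬ T x → x ≡ false
    ¬T⇒≡ {false} _ = refl
    ¬T⇒≡ {true}  h = ⊥-elim (h _)

    bit : Bool → ℝ
    bit x = if x then 1# else 0#

    bit-nonneg : ∀ x → 0# ≤ bit x
    bit-nonneg true  = 0≤1
    bit-nonneg false = ≤.refl

    bit≤1 : ∀ x → bit x ≤ 1#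
    bit≤1 true  = ≤.refl
    bit≤1 false = 0≤1

    x≤y+x : ∀ {x y} → 0# ≤ y → x ≤ y + x
    x≤y+x {x} 0≤y = ≤.trans (≤.reflexive (Eq.sym (+-identityˡ x))) (+-monoˡ-≤ x 0≤y)

    -- Sequences of bits with at most one 1.
    Single : (ℕ → Bool) → Set
    Single s = ∀ m n → m ≢ n → T (s m) → ¬ T (s n)

    Single-suc : ∀ {s} → Single s → Single (s ∘ suc)
    Single-suc h m n m≢n = h (suc m) (suc n) (λ { refl → m≢n refl })

    ∑-zero : ∀ n s → (∀ i → ¬ T (s i)) → ∑ n (bit ∘ s) ≈ 0#
    ∑-zero zero    s h = Eq.refl
    ∑-zero (suc n) s h rewrite ¬T⇒≡ (h 0) =
      Eq.trans (+-identityˡ _) (∑-zero n (s ∘ suc) (h ∘ suc))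

    ∑-single : ∀ n s → Single s → ∑ n (bit ∘ s) ≤ 1#
    ∑-single zero    s h = 0≤1
    ∑-single (suc n) s h with s 0 in eq
    ... | true  = ≤.reflexive (Eq.trans
                    (+-congˡ (∑-zero n (s ∘ suc) λ i → h 0 (suc i) (λ ()) (subst T (sym eq) _)))
                    (+-identityʳ 1#))
    ... | false = ≤.trans (≤.reflexive (+-identityˡ _)) (∑-single n (s ∘ suc) (Single-suc h))

    ∑-nonneg : ∀ n s → 0# ≤ ∑ n (bit ∘ s)
    ∑-nonneg zero    s = ≤.refl
    ∑-nonneg (suc n) s = ≤.trans (∑-nonneg n (s ∘ suc)) (x≤y+x (bit-nonneg (s 0)))

    ∑-hit : ∀ n s → T (s n) → 1# ≤ ∑ (suc n) (bit ∘ s)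
    ∑-hit zero    s h rewrite T⇒≡ h = ≤.reflexive (Eq.sym (+-identityʳ 1#))
    ∑-hit (suc n) s h = ≤.trans (∑-hit n (s ∘ suc) h) (x≤y+x (bit-nonneg (s 0)))

    ∑-bit : ∀ s → Single s → IsSeriesSum (bit ∘ s) (bit (does (em {P = ∃[ n ] T (s n)})))
    ∑-bit s h with em {P = ∃[ n ] T (s n)}
    ... | yes (n , t) = (λ { (k , e) → ≤.trans (≤.reflexive e) (∑-single k s h) })
                      , (λ v ub → ≤.trans (∑-hit n s t) (ub (suc n , Eq.refl)))
    ... | no none     = (λ { (k , e) → ≤.reflexive
                              (Eq.trans e (∑-zero k s λ i t → none (i , t))) })
                      , (λ v ub → ub (0 , Eq.refl))

  δ : (X : MeasurableSpace ℓ) → Point X → SubProb X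
  δ X s = record
    { μ          = λ A → indicator (proj₁ A) s
    ; μ-cong     = λ A B A≐B → Eq.reflexive (cong bit (A≐B s))
    ; μ-nonneg   = λ A → bit-nonneg (proj₁ A s)
    ; μ-empty    = Eq.refl
    ; μ-additive = λ A dis → ∑-bit (λ n → proj₁ (A n) s) (λ m n m≢n → dis m n m≢n s)
    ; μ-subprob  = λ A → bit≤1 (proj₁ A s)
    }

  -- The elements of 𝒱(X).
  record UpClosed (X : MeasurableSpace ℓ) : Set ℓ where
    field
      family     : Pow (Pow (SubProb X))
      measurable : ∀ W → W ∈ family → Measurable (Sub X) W
      upward     : ∀ V W → Measurable (Sub X) W → V ⊆ W → V ∈ family → W ∈ family

  open UpClosed public using (family)

  TMeasurable : (X : MeasurableSpace ℓ) → (Point X → UpClosed X) → Set ℓ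
  TMeasurable X P =
    (H : Pow (SubProb X × Interval)) → Measurable (Sub X ⊗ unitInterval) H →
    Measurable (X ⊗ unitInterval) (λ (s , q) → family (P s) (λ ν → H (ν , q)))

  record StochasticEffectivity (X : MeasurableSpace ℓ) : Set ℓ where
    field
      eff         : Point X → UpClosed X
      tmeasurable : TMeasurable X eff

    Effective : Point X → Pow (SubProb X) → Bool
    Effective s W = family (eff s) W

  open StochasticEffectivity public using (eff; Effective)

  record GameFrame {g} (Γ : Set g) (ε : Γ) ℓ : Set (g ⊔ lsuc ℓ) where
    field
      S       : MeasurableSpace ℓ
      P       : Γ → StochasticEffectivity S
      P-empty : ∀ s W → W ∈ Effective (P ε) s ⇔ (Measurable (Sub S) W × δ S s ∈ W)

  ≤-resp : ∀ {a b c d} → a ≈ b → c ≈ d → a ≤ c → b ≤ d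
  ≤-resp e f h = ≤.trans (≤.reflexive (Eq.sym e)) (≤.trans h (≤.reflexive f))
  <-resp : ∀ {a b c d} → a ≈ b → c ≈ d → a < c → b < d
  <-resp e f (h , n) = ≤-resp e f h , λ b≈d → n (Eq.trans e (Eq.trans b≈d (Eq.sym f)))

  open import Algebra.Properties.Semiring.Mult semiring using (×-homo-+; ×1-homo-*)

  ι : ℕ → ℝ
  ι n = n · 1#

  ι-nonneg : ∀ n → 0# ≤ ι n
  ι-nonneg zero = ≤.refl
  ι-nonneg (suc n) = ≤.trans (ι-nonneg n) (≤-resp (+-identityˡ _) Eq.refl (+-monoˡ-≤ (ι n) 0≤1))

  ι≉0 : ∀ n → ¬ (ι (suc n) ≈ 0#)
  ι≉0 n e = 0≉1 (≤.antisym 0≤1 (≤.trans h (≤.reflexive e)))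
    where h : 1# ≤ 1# + ι n
          h = ≤-resp (Eq.trans (+-comm _ _) (+-identityʳ 1#)) (+-comm _ _) (+-monoˡ-≤ 1# (ι-nonneg n))

  cancel : ∀ d {x y} → x * ι (suc d) ≈ y * ι (suc d) → x ≈ y
  cancel d {x} {y} e = Eq.trans (Eq.sym (h x)) (Eq.trans (*-congʳ e) (h y))
    where h : ∀ x → (x * ι (suc d)) * (ι (suc d) ⁻¹) ≈ x
          h x = Eq.trans (*-assoc _ _ _) (Eq.trans (*-congˡ (*-inverseʳ (ι≉0 d))) (*-identityʳ x))

  clear : ∀ n d → (ι n * (ι (suc d) ⁻¹)) * ι (suc d) ≈ ι n
  clear n d = Eq.trans (*-assoc _ _ _) (Eq.trans (*-congˡ (Eq.trans (*-comm _ _) (*-inverseʳ (ι≉0 d)))) (*-identityʳ _))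

  num : ∀ p → 0ℚ ℚ.≤ p → ∃[ n ] ℚ.numerator p ≡ ℤ.+ n
  num (mkℚ (ℤ.+ n) _ _) h = n , refl
  num p@(mkℚ ℤ.-[1+ n ] _ _) h with ℤ.NonNegative.nonNeg (ℚ.nonNegative {p} h)
  ... | ()

  open import Relation.Binary.Reasoning.Setoid Eq.setoid

  swap₄ : ∀ a b c → (a * b) * c ≈ (a * c) * b
  swap₄ a b c = Eq.trans (*-assoc a b c) (Eq.trans (*-congˡ (*-comm b c)) (Eq.sym (*-assoc a c b)))

  fromℚ-+ : ∀ p q → 0ℚ ℚ.≤ p → 0ℚ ℚ.≤ q → fromℚ (p ℚ.+ q) ≈ fromℚ p + fromℚ q
  fromℚ-+ p q 0≤p 0≤q with num p 0≤p | num q 0≤q | num (p ℚ.+ q) (ℚ.+-mono-≤ 0≤p 0≤q) | ℚ.toℚᵘ-homo-+ p q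
  fromℚ-+ (mkℚ _ b₁ c₁) (mkℚ _ b₂ c₂) 0≤p 0≤q | m , refl | n , refl | k , e | ℚᵘ.*≡* eq
    with (mkℚ (ℤ.+ m) b₁ c₁) ℚ.+ (mkℚ (ℤ.+ n) b₂ c₂)
  fromℚ-+ (mkℚ _ b₁ c₁) (mkℚ _ b₂ c₂) 0≤p 0≤q | m , refl | n , refl | .k , refl | ℚᵘ.*≡* eq | mkℚ (ℤ.+ k) d _ = goal
    where
    D E F : ℝ
    D = ι (suc b₁) ; E = ι (suc b₂) ; F = ι (suc d)
    eqℕ : k ℕ.* (suc b₁ ℕ.* suc b₂) ≡ (m ℕ.* suc b₂ ℕ.+ n ℕ.* suc b₁) ℕ.* suc d
    eqℕ = ℤ.+-injective (trans (ℤ.pos-* k (suc b₁ ℕ.* suc b₂))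
      (trans eq (trans (cong (ℤ._* (ℤ.+ suc d)) (trans (cong₂ ℤ._+_ (sym (ℤ.pos-* m (suc b₂))) (sym (ℤ.pos-* n (suc b₁)))) refl))
        (sym (ℤ.pos-* (m ℕ.* suc b₂ ℕ.+ n ℕ.* suc b₁) (suc d))))))
    eqℝ : ι k * (D * E) ≈ (ι m * E + ι n * D) * F
    eqℝ = begin
      ι k * (D * E) ≈⟨ *-congˡ (×1-homo-* (suc b₁) (suc b₂)) ⟨
      ι k * ι (suc b₁ ℕ.* suc b₂) ≈⟨ ×1-homo-* k _ ⟨
      ι (k ℕ.* (suc b₁ ℕ.* suc b₂)) ≡⟨ cong ι eqℕ ⟩
      ι ((m ℕ.* suc b₂ ℕ.+ n ℕ.* suc b₁) ℕ.* suc d) ≈⟨ ×1-homo-* (m ℕ.* suc b₂ ℕ.+ n ℕ.* suc b₁) (suc d) ⟩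
      ι (m ℕ.* suc b₂ ℕ.+ n ℕ.* suc b₁) * F ≈⟨ *-congʳ (×-homo-+ 1# (m ℕ.* suc b₂) (n ℕ.* suc b₁)) ⟩
      (ι (m ℕ.* suc b₂) + ι (n ℕ.* suc b₁)) * F ≈⟨ *-congʳ (+-cong (×1-homo-* m (suc b₂)) (×1-homo-* n (suc b₁))) ⟩
      (ι m * E + ι n * D) * F ∎
    x y z : ℝ
    x = ι m * (D ⁻¹) ; y = ι n * (E ⁻¹) ; z = ι k * (F ⁻¹)
    goal : z ≈ x + y
    goal = cancel d (cancel b₁ (cancel b₂ (begin
      ((z * F) * D) * E ≈⟨ *-congʳ (*-congʳ (clear k d)) ⟩
      (ι k * D) * E ≈⟨ *-assoc _ _ _ ⟩
      ι k * (D * E) ≈⟨ eqℝ ⟩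
      (ι m * E + ι n * D) * F ≈⟨ *-congʳ (+-cong (*-congʳ (Eq.sym (clear m b₁))) (*-congʳ (Eq.sym (clear n b₂)))) ⟩
      ((x * D) * E + (y * E) * D) * F ≈⟨ *-congʳ (+-congˡ (swap₄ y E D)) ⟩
      ((x * D) * E + (y * D) * E) * F ≈⟨ *-congʳ (distribʳ E _ _) ⟨
      ((x * D + y * D) * E) * F ≈⟨ *-congʳ (*-congʳ (distribʳ D x y)) ⟨
      (((x + y) * D) * E) * F ≈⟨ swap₄ _ E F ⟩
      (((x + y) * D) * F) * E ≈⟨ *-congʳ (swap₄ _ D F) ⟩
      (((x + y) * F) * D) * E ∎)))

  -- Q²(q) and Q^∞(q).  As the terms are nonnegative, Σᵢ aᵢ ≤ q for an infinite
  -- sequence says that all partial sums are ≤ q.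
  Q² : ℝ → Pred (ℚ × ℚ) 0ℓ
  Q² q (a₁ , a₂) = 0ℚ ℚ.≤ a₁ × 0ℚ ℚ.≤ a₂ × fromℚ a₁ + fromℚ a₂ ≤ q

  Q^∞ : ℝ → Pred (ℕ → ℚ) 0ℓ
  Q^∞ q a = (∀ i → 0ℚ ℚ.≤ a i) × (∀ n → ∑ n (fromℚ ∘ a) ≤ q)

  module Interpretation
    (Λ : SubProb unitInterval)  -- the measure dr of ∫₀¹ … dr
    {g ℓ : Level} {Γ : Set g} {ε : Γ} (𝒢 : GameFrame Γ ε ℓ)
    where

    open GameFrame 𝒢

    -- The type of (A , q) ↦ 𝔍(τ ∣ A, q).
    Value : Set ℓ
    Value = Event S → ℝ → Pow (Point S)

    dual : Value → Value
    dual f A q = ∁ (f (∁ᴱ {X = S} A) q)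

    choice : Value → Value → Value
    choice f g A q =
      ⟪ s ∣ (∀ a → Q² q a → s ∈ f A (fromℚ (proj₁ a)) ∪ g A (fromℚ (proj₂ a))) ⟫

    -- { ν ∣ ∫₀¹ ν(f A r) dr > q }.  That the integral makes sense is part of
    -- the condition: all f A r, and r ↦ ν(f A r), have to be measurable.
    G : Value → Event S → ℝ → Pow (SubProb S)
    G f A q = ⟪ ν ∣ (Σ[ m ∈ ((r : Interval) → Measurable S (f A (proj₁ r))) ] ∃[ x ]
      IsIntegral unitInterval Λ (λ r → μ ν (f A (proj₁ r) , m r)) x × q < x) ⟫

    after : Γ → Value → Value
    after γ f A q s = Effective (P γ) s (G f A q)

    iterate : (Value → Value) → ℕ → Value → Value
    iterate F zero    f = f
    iterate F (suc n) f = F (iterate F n f)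

    angelic : (Value → Value) → Value → Value
    angelic F f A q =
      ⟪ s ∣ (∀ a → Q^∞ q a → ∃[ n ] s ∈ iterate F n f A (fromℚ (a n))) ⟫

    -- τ ▷ f is the value of τ ; τ₀ when f is the value of τ₀.  The clauses for
    -- τᵈ ; τ₀, (τ₁ ∩ τ₂) ; τ₀ and τˣ ; τ₀ rewrite these games, according to the
    -- identifications, to (τ ; τ₀ᵈ)ᵈ, (τ₁ᵈ ∪ τ₂ᵈ)ᵈ ; τ₀ and ((τᵈ)* ; τ₀ᵈ)ᵈ.
    infixr 7 _▷_
    _▷_ : Game Γ → Value → Value
    prim γ     ▷ f = after γ f
    (τ ᵈ)      ▷ f = dual (τ ▷ dual f)
    (τ₁ ∪ᵍ τ₂) ▷ f = choice (τ₁ ▷ f) (τ₂ ▷ f)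
    (τ₁ ∩ᵍ τ₂) ▷ f = dual (choice (dual (τ₁ ▷ f)) (dual (τ₂ ▷ f)))
    (τ₁ ⨾ τ₂)  ▷ f = τ₁ ▷ τ₂ ▷ f
    (τ ✶)      ▷ f = angelic (τ ▷_) f
    (τ ✕)      ▷ f = dual (angelic (λ h → dual (τ ▷ dual h)) (dual f))

    atomic : Γ → Value
    atomic γ A q s = Effective (P γ) s (β S A q)

    -- A bare τ* is read as τ* ; ε, hence a bare τˣ as ((τᵈ)* ; ε)ᵈ.
    𝔍 : Game Γ → Value
    𝔍 (prim γ)   = atomic γ
    𝔍 (τ ᵈ)      = dual (𝔍 τ)
    𝔍 (τ₁ ∪ᵍ τ₂) = choice (𝔍 τ₁) (𝔍 τ₂)
    𝔍 (τ₁ ∩ᵍ τ₂) = dual (choice (dual (𝔍 τ₁)) (dual (𝔍 τ₂)))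
    𝔍 (τ₁ ⨾ τ₂)  = τ₁ ▷ 𝔍 τ₂
    𝔍 (τ ✶)      = (τ ✶) ▷ atomic ε
    𝔍 (τ ✕)      = dual ((τ ᵈ) ✶ ▷ atomic ε)

    -- The equations up to 𝔍-✶ are the defining clauses of the interpretation;
    -- 𝔍-sound, below, says that 𝔍 is compatible with the identifications ∼.

    power : Game Γ → ℕ → Game Γ → Game Γ
    power τ zero    τ₀ = τ₀
    power τ (suc n) τ₀ = τ ⨾ power τ n τ₀

    𝔍-prim : ∀ γ A q s → 𝔍 (prim γ) A q s ≡ Effective (P γ) s (β S A q)
    𝔍-prim γ A q s = refl

    𝔍-dual : ∀ τ A q s → 𝔍 (τ ᵈ) A q s ≡ ∁ (𝔍 τ (∁ᴱ {X = S} A) q) s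
    𝔍-dual τ A q s = refl

    𝔍-∪ : ∀ τ₁ τ₂ A q → 𝔍 (τ₁ ∪ᵍ τ₂) A q ≐
      ⟪ s ∣ (∀ a → Q² q a → s ∈ 𝔍 τ₁ A (fromℚ (proj₁ a)) ∪ 𝔍 τ₂ A (fromℚ (proj₂ a))) ⟫
    𝔍-∪ τ₁ τ₂ A q s = refl

    𝔍-∪-⨾ : ∀ τ₁ τ₂ τ → 𝔍 ((τ₁ ∪ᵍ τ₂) ⨾ τ) ≡ 𝔍 ((τ₁ ⨾ τ) ∪ᵍ (τ₂ ⨾ τ))
    𝔍-∪-⨾ τ₁ τ₂ τ = refl

    𝔍-prim-⨾ : ∀ γ τ A q s → 𝔍 (prim γ ⨾ τ) A q s ≡ Effective (P γ) s (G (𝔍 τ) A q)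
    𝔍-prim-⨾ γ τ A q s = refl

    𝔍-power : ∀ τ n τ₀ → 𝔍 (power τ n τ₀) ≡ iterate (τ ▷_) n (𝔍 τ₀)
    𝔍-power τ zero    τ₀ = refl
    𝔍-power τ (suc n) τ₀ = cong (τ ▷_) (𝔍-power τ n τ₀)

    𝔍-✶-⨾ : ∀ τ τ₀ A q → 𝔍 (τ ✶ ⨾ τ₀) A q ≐
      ⟪ s ∣ (∀ a → Q^∞ q a → ∃[ n ] s ∈ 𝔍 (power τ n τ₀) A (fromℚ (a n))) ⟫
    𝔍-✶-⨾ τ τ₀ A q s = does-cong
      (λ H a Qa → let n , t = H a Qa in n , subst (λ f → T (f A _ s)) (sym (𝔍-power τ n τ₀)) t)
      (λ H a Qa → let n , t = H a Qa in n , subst (λ f → T (f A _ s)) (𝔍-power τ n τ₀) t)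

    𝔍-✶ : ∀ τ → 𝔍 (τ ✶) ≡ 𝔍 (τ ✶ ⨾ prim ε)
    𝔍-✶ τ = refl

    -- Equality of values at extensionally equal events; reflexive only for
    -- values that respect equality of events.
    infix 4 _≋_
    _≋_ : Value → Value → Set ℓ
    f ≋ h = ∀ A B → proj₁ A ≐ proj₁ B → ∀ q → f A q ≐ h B q

    ≐-sym : ∀ {a} {X : Set a} {A B : Pow X} → A ≐ B → B ≐ A
    ≐-sym e x = sym (e x)

    ≋-sym : ∀ {f h} → f ≋ h → h ≋ f
    ≋-sym e A B A≐B q s = sym (e B A (≐-sym A≐B) q s)
    ≋-trans : ∀ {f h k} → f ≋ h → h ≋ k → f ≋ k
    ≋-trans e e′ A B A≐B q s = trans (e A B A≐B q s) (e′ B B (λ _ → refl) q s)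

    dual-cong : ∀ {f h} → f ≋ h → dual f ≋ dual h
    dual-cong e A B A≐B q s = cong not (e (∁ᴱ {X = S} A) (∁ᴱ {X = S} B) (λ x → cong not (A≐B x)) q s)

    dual-invol : ∀ {f h} → f ≋ h → dual (dual f) ≋ h
    dual-invol e A B A≐B q s = trans (not-involutive _) (e _ B (λ x → trans (not-involutive _) (A≐B x)) q s)

    choice-cong : ∀ {f f′ h h′} → f ≋ f′ → h ≋ h′ → choice f h ≋ choice f′ h′
    choice-cong e e′ A B A≐B q s = does-cong
      (λ H a Qa → subst T (cong₂ _∨_ (e A B A≐B _ s) (e′ A B A≐B _ s)) (H a Qa))
      (λ H a Qa → subst T (sym (cong₂ _∨_ (e A B A≐B _ s) (e′ A B A≐B _ s))) (H a Qa))

    choice-comm : ∀ f h A q s → s ∈ choice f h A q → s ∈ choice h f A q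
    choice-comm f h A q s H = T-em λ { (a , b) (0≤a , 0≤b , le) →
      subst T (∨-comm (f A (fromℚ b) s) _) (em-T H (b , a) (0≤b , 0≤a , ≤-resp (+-comm _ _) Eq.refl le)) }

    choice-mono : ∀ {f f′ h h′} A s → (∀ q → s ∈ f A q → s ∈ f′ A q) → (∀ q → s ∈ h A q → s ∈ h′ A q) →
      ∀ q → s ∈ choice f h A q → s ∈ choice f′ h′ A q
    choice-mono {f} {f′} {h} {h′} A s F H q X = T-em λ a Qa →
      or (f A _ s) (f′ A _ s) _ _ (F _) (H _) (em-T X a Qa)
      where or : ∀ x x′ y y′ → (T x → T x′) → (T y → T y′) → T (x ∨ y) → T (x′ ∨ y′)
            or true true y y′ p q t = _
            or true false y y′ p q t = ⊥-elim (p _)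
            or false true y y′ p q t = _
            or false false y y′ p q t = q t

    choice-assoc₁ : ∀ f h k A q s → s ∈ choice (choice f h) k A q → s ∈ choice f (choice h k) A q
    choice-assoc₁ f h k A q s X = T-em λ { (a , b) (0≤a , 0≤b , le) → or (f A (fromℚ a) s) _ λ ¬f →
        T-em λ { (c , d) (0≤c , 0≤d , le′) →
          or′ (choice f h A (fromℚ (a ℚ.+ c)) s) _ _
            (λ Y → case (f A (fromℚ a) s) _ ¬f (em-T Y (a , c) (0≤a , 0≤c , ≤.reflexive (Eq.sym (fromℚ-+ a c 0≤a 0≤c)))))
            (em-T X (a ℚ.+ c , d) (ℚ.+-mono-≤ 0≤a 0≤c , 0≤d ,
               ≤.trans (≤-resp (Eq.trans (+-comm _ _) (Eq.trans (Eq.sym (+-assoc _ _ _)) (+-congʳ (Eq.sym (fromℚ-+ a c 0≤a 0≤c)))))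
                               (+-comm _ _) (+-monoˡ-≤ (fromℚ a) le′)) le)) } }
      where or : ∀ x y → (¬ T x → T y) → T (x ∨ y)
            or true y h = _
            or false y h = h id
            case : ∀ x y → ¬ T x → T (x ∨ y) → T y
            case true y n t = ⊥-elim (n _)
            case false y n t = t
            or′ : ∀ x y z → (T x → T y) → T (x ∨ z) → T (y ∨ z)
            or′ true true z p t = _
            or′ true false z p t = ⊥-elim (p _)
            or′ false true z p t = _
            or′ false false z p t = t

    choice-assoc : ∀ f h k → choice (choice f h) k ≋ choice (choice f h) k → choice f (choice h k) ≋ choice f (choice h k)
      → choice (choice f h) k ≋ choice f (choice h k)
    choice-assoc f h k e e′ A B A≐B q s = trans (e A B A≐B q s) (bool-ext (choice-assoc₁ f h k B q s) back)
      where
      back : s ∈ choice f (choice h k) B q → s ∈ choice (choice f h) k B q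
      back X = choice-comm k (choice f h) B q s
        (choice-mono {k} {k} {choice h f} {choice f h} B s (λ _ → id) (λ q → choice-comm h f B q s) q
        (choice-assoc₁ k h f B q s
        (choice-mono {choice h k} {choice k h} {f} {f} B s (λ q → choice-comm h k B q s) (λ _ → id) q
        (choice-comm f (choice h k) B q s X))))

    IsIntegral-cong : ∀ {f h x} → (∀ t → f t ≈ h t) → IsIntegral unitInterval Λ f x → IsIntegral unitInterval Λ h x
    IsIntegral-cong e (m , ub , lub) =
      (λ c → resp (λ t → does-cong (<-resp Eq.refl (e t)) (<-resp Eq.refl (Eq.sym (e t)))) (m c)) ,
      (λ { (k , c , E , 0≤c , le , eq) → ub (k , c , E , 0≤c , (λ t → ≤-resp Eq.refl (Eq.sym (e t)) (le t)) , eq) }) ,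
      (λ v w → lub v (λ { (k , c , E , 0≤c , le , eq) → w (k , c , E , 0≤c , (λ t → ≤-resp Eq.refl (e t) (le t)) , eq) }))

    G-cong₁ : ∀ {f h} → f ≋ h → ∀ A B → proj₁ A ≐ proj₁ B → ∀ q ν → ν ∈ G f A q → ν ∈ G h B q
    G-cong₁ {f} {h} e A B A≐B q ν X with em-T X
    ... | m , x , int , q<x = T-em
      ( (λ r → ≐-measurable S (e A B A≐B (proj₁ r)) (m r)) , x
      , IsIntegral-cong (λ r → SubProb.μ-cong ν _ _ (e A B A≐B (proj₁ r))) int , q<x)

    eff-cong₁ : ∀ γ s {V W} → V ≐ W → T (Effective (P γ) s V) → T (Effective (P γ) s W)
    eff-cong₁ γ s {V} {W} e t = UpClosed.upward (eff (P γ) s) V W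
      (resp e (UpClosed.measurable (eff (P γ) s) V t)) (λ x → subst T (e x)) t

    eff-cong : ∀ γ s {V W} → V ≐ W → Effective (P γ) s V ≡ Effective (P γ) s W
    eff-cong γ s e = bool-ext (eff-cong₁ γ s e) (eff-cong₁ γ s (≐-sym e))

    after-cong : ∀ γ {f h} → f ≋ h → after γ f ≋ after γ h
    after-cong γ e A B A≐B q s = eff-cong γ s λ ν →
      bool-ext (G-cong₁ e A B A≐B q ν) (G-cong₁ (≋-sym e) B A (≐-sym A≐B) q ν)

    iterate-cong : ∀ {F F′} → (∀ {f h} → f ≋ h → F f ≋ F′ h) → ∀ n {f h} → f ≋ h → iterate F n f ≋ iterate F′ n h
    iterate-cong E zero e = e
    iterate-cong E (suc n) e = E (iterate-cong E n e)

    angelic-cong : ∀ {F F′ f h} → (∀ {f h} → f ≋ h → F f ≋ F′ h) → f ≋ h → angelic F f ≋ angelic F′ h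
    angelic-cong E e A B A≐B q s = does-cong
      (λ H a Qa → let n , t = H a Qa in n , subst T (iterate-cong E n e A B A≐B _ s) t)
      (λ H a Qa → let n , t = H a Qa in n , subst T (sym (iterate-cong E n e A B A≐B _ s)) t)

    atomic-cong : ∀ γ → atomic γ ≋ atomic γ
    atomic-cong γ A B A≐B q s = eff-cong γ s λ ν → does-cong
      (<-resp Eq.refl (SubProb.μ-cong ν A B A≐B)) (<-resp Eq.refl (Eq.sym (SubProb.μ-cong ν A B A≐B)))

    ▷-cong : ∀ τ {f h} → f ≋ h → τ ▷ f ≋ τ ▷ h
    ▷-cong (prim γ) e = after-cong γ e
    ▷-cong (τ ᵈ) e = dual-cong (▷-cong τ (dual-cong e))
    ▷-cong (σ ∪ᵍ τ) e = choice-cong (▷-cong σ e) (▷-cong τ e)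
    ▷-cong (σ ∩ᵍ τ) e = dual-cong (choice-cong (dual-cong (▷-cong σ e)) (dual-cong (▷-cong τ e)))
    ▷-cong (σ ⨾ τ) e = ▷-cong σ (▷-cong τ e)
    ▷-cong (τ ✶) e = angelic-cong (▷-cong τ) e
    ▷-cong (τ ✕) e = dual-cong (angelic-cong (λ e → dual-cong (▷-cong τ (dual-cong e))) (dual-cong e))

    𝔍-cong : ∀ τ → 𝔍 τ ≋ 𝔍 τ
    𝔍-cong (prim γ) = atomic-cong γ
    𝔍-cong (τ ᵈ) = dual-cong (𝔍-cong τ)
    𝔍-cong (σ ∪ᵍ τ) = choice-cong (𝔍-cong σ) (𝔍-cong τ)
    𝔍-cong (σ ∩ᵍ τ) = dual-cong (choice-cong (dual-cong (𝔍-cong σ)) (dual-cong (𝔍-cong τ)))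
    𝔍-cong (σ ⨾ τ) = ▷-cong σ (𝔍-cong τ)
    𝔍-cong (τ ✶) = ▷-cong (τ ✶) (atomic-cong ε)
    𝔍-cong (τ ✕) = dual-cong (▷-cong ((τ ᵈ) ✶) (atomic-cong ε))

    module Choice {f h k f′ h′ k′ : Value} (ef : f ≋ f′) (eh : h ≋ h′) (ek : k ≋ k′) where
      rf : f ≋ f
      rf = ≋-trans ef (≋-sym ef)
      rh : h ≋ h
      rh = ≋-trans eh (≋-sym eh)
      rk : k ≋ k
      rk = ≋-trans ek (≋-sym ek)
      comm : choice f h ≋ choice h′ f′
      comm A B A≐B q s = trans (choice-cong ef eh A B A≐B q s)
        (bool-ext (choice-comm f′ h′ B q s) (choice-comm h′ f′ B q s))
      assoc : choice (choice f h) k ≋ choice f′ (choice h′ k′)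
      assoc = ≋-trans (choice-assoc f h k (choice-cong (choice-cong rf rh) rk) (choice-cong rf (choice-cong rh rk)))
                (choice-cong ef (choice-cong eh ek))

    ∩-assoc-lemma : ∀ {f h k f′ h′ k′} → f ≋ f′ → h ≋ h′ → k ≋ k′ →
      dual (choice (dual (dual (choice (dual f) (dual h)))) (dual k)) ≋
      dual (choice (dual f′) (dual (dual (choice (dual h′) (dual k′)))))
    ∩-assoc-lemma ef eh ek = dual-cong (≋-trans
      (choice-cong (dual-invol (choice-cong (dual-cong ef) (dual-cong eh))) (dual-cong ek))
      (≋-trans (Choice.assoc (r (≋-sym ef)) (r (≋-sym eh)) (r (≋-sym ek)))
      (≋-sym (choice-cong (r (≋-sym ef)) (dual-invol (choice-cong (r (≋-sym eh)) (r (≋-sym ek))))))))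
      where r : ∀ {f f′} → f ≋ f′ → dual f ≋ dual f
            r e = dual-cong (≋-trans e (≋-sym e))

    ▷-sound : ∀ {σ τ} → σ ∼ τ → ∀ {f h} → f ≋ h → σ ▷ f ≋ τ ▷ h
    ▷-sound {σ} ∼-refl e = ▷-cong σ e
    ▷-sound (∼-sym p) e = ≋-sym (▷-sound p (≋-sym e))
    ▷-sound (∼-trans p p′) e = ≋-trans (▷-sound p e) (▷-sound p′ (≋-trans (≋-sym e) e))
    ▷-sound (ᵈ-cong p) e = dual-cong (▷-sound p (dual-cong e))
    ▷-sound (∪-cong p p′) e = choice-cong (▷-sound p e) (▷-sound p′ e)
    ▷-sound (∩-cong p p′) e = dual-cong (choice-cong (dual-cong (▷-sound p e)) (dual-cong (▷-sound p′ e)))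
    ▷-sound (⨾-cong p p′) e = ▷-sound p (▷-sound p′ e)
    ▷-sound (✶-cong p) e = angelic-cong (▷-sound p) e
    ▷-sound (✕-cong p) e = dual-cong (angelic-cong (λ e → dual-cong (▷-sound p (dual-cong e))) (dual-cong e))
    ▷-sound (ᵈ-invol τ) e = dual-invol (▷-cong τ (dual-invol e))
    ▷-sound (∩-dual σ τ) e = dual-cong (choice-cong
      (dual-cong (▷-cong σ (≋-sym (dual-invol (≋-sym e))))) (dual-cong (▷-cong τ (≋-sym (dual-invol (≋-sym e))))))
    ▷-sound (✕-dual τ) e = dual-invol (angelic-cong (λ e → dual-cong (▷-cong τ (dual-cong e))) (dual-invol e))
    ▷-sound (⨾-distribʳ-∪ ρ σ τ) e = choice-cong (▷-cong ρ (▷-cong τ e)) (▷-cong σ (▷-cong τ e))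
    ▷-sound (⨾-dual σ τ) e = dual-cong (▷-cong σ (≋-sym (dual-invol (▷-cong τ (dual-cong (≋-sym e))))))
    ▷-sound (∪-comm σ τ) e = Choice.comm (▷-cong σ e) (▷-cong τ e) (▷-cong τ e)
    ▷-sound (∩-comm σ τ) e = dual-cong (Choice.comm (dual-cong (▷-cong σ e)) (dual-cong (▷-cong τ e)) (▷-cong τ e))
    ▷-sound (∪-assoc ρ σ τ) e = Choice.assoc (▷-cong ρ e) (▷-cong σ e) (▷-cong τ e)
    ▷-sound (∩-assoc ρ σ τ) e = ∩-assoc-lemma (▷-cong ρ e) (▷-cong σ e) (▷-cong τ e)
    ▷-sound (⨾-assoc ρ σ τ) e = ▷-cong ρ (▷-cong σ (▷-cong τ e))

    𝔍-sound : ∀ {σ τ} → σ ∼ τ → 𝔍 σ ≋ 𝔍 τ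
    𝔍-sound {σ} ∼-refl = 𝔍-cong σ
    𝔍-sound (∼-sym p) = ≋-sym (𝔍-sound p)
    𝔍-sound (∼-trans p p′) = ≋-trans (𝔍-sound p) (𝔍-sound p′)
    𝔍-sound (ᵈ-cong p) = dual-cong (𝔍-sound p)
    𝔍-sound (∪-cong p p′) = choice-cong (𝔍-sound p) (𝔍-sound p′)
    𝔍-sound (∩-cong p p′) = dual-cong (choice-cong (dual-cong (𝔍-sound p)) (dual-cong (𝔍-sound p′)))
    𝔍-sound (⨾-cong p p′) = ▷-sound p (𝔍-sound p′)
    𝔍-sound (✶-cong p) = ▷-sound (✶-cong p) (atomic-cong ε)
    𝔍-sound (✕-cong p) = dual-cong (▷-sound (✶-cong (ᵈ-cong p)) (atomic-cong ε))
    𝔍-sound (ᵈ-invol τ) = dual-invol (𝔍-cong τ)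
    𝔍-sound (∩-dual σ τ) = 𝔍-cong (σ ∩ᵍ τ)
    𝔍-sound (✕-dual τ) = dual-invol (▷-cong ((τ ᵈ) ✶) (atomic-cong ε))
    𝔍-sound (⨾-distribʳ-∪ ρ σ τ) = choice-cong (▷-cong ρ (𝔍-cong τ)) (▷-cong σ (𝔍-cong τ))
    𝔍-sound (⨾-dual σ τ) = dual-cong (▷-cong σ (≋-sym (dual-invol (𝔍-cong τ))))
    𝔍-sound (∪-comm σ τ) = Choice.comm (𝔍-cong σ) (𝔍-cong τ) (𝔍-cong τ)
    𝔍-sound (∩-comm σ τ) = dual-cong (Choice.comm (dual-cong (𝔍-cong σ)) (dual-cong (𝔍-cong τ)) (𝔍-cong τ))
    𝔍-sound (∪-assoc ρ σ τ) = Choice.assoc (𝔍-cong ρ) (𝔍-cong σ) (𝔍-cong τ)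
    𝔍-sound (∩-assoc ρ σ τ) = ∩-assoc-lemma (𝔍-cong ρ) (𝔍-cong σ) (𝔍-cong τ)
    𝔍-sound (⨾-assoc ρ σ τ) = ▷-cong ρ (▷-cong σ (𝔍-cong τ))

{-# OPTIONS --safe #-}

-- The invariant carried through the induction on games is joint measurability:
-- { (s , q) ∣ s ∈ 𝔍(τ ∣ A, q) } belongs to S ⊗ [0,1].
--
-- For γ ; τ this needs { (ν , q) ∣ ∫ ν(E_r) dr > q } to be measurable when E is.
-- By the π-λ theorem (ν , r) ↦ ν(E_r) is measurable, and the integral is the
-- supremum of the sums Σ_k c Λ{ r ∣ ν(E_r) > (k + 1) c }, c = 1/n, each of which
-- is measurable in ν by the π-λ theorem again.
--
-- For τ*, the complement of 𝔍(τ* ; τ₀ ∣ A, q) is a Souslin set for each q, but S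
-- is closed under the Souslin operation while S ⊗ [0,1] need not be.  This
-- complement increases with q.  Off its threshold t(s) it is described by its
-- members for q in a countable dense set; at the threshold, membership says that
-- some sequence with sum at most t(s) is losing, and this is a Souslin condition on
-- s alone.

module Submission where

open import Level using (Level; _⊔_; 0ℓ)
import Algebra.Solver.Ring.NaturalCoefficients.Default as SemiringSolver
open import Axiom.ExcludedMiddle using (ExcludedMiddle)
open import Data.Bool.Base using (true; false; T; not; _∧_; _∨_; if_then_else_)
open import Data.Bool.Properties using (T-∧; T-∨; ∧-comm; ∧-zeroʳ; ∧-identityʳ; ∨-inverseʳ)
open import Data.Empty using (⊥-elim)
open import Data.Fin.Base using (Fin; toℕ)
open import Data.Fin.Properties using (toℕ<n)
open import Data.Integer.Base as ℤ using ()
open import Data.List.Base using (List; []; _∷_; length; applyUpTo)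
open import Data.List.Properties using (length-applyUpTo)
open import Data.Nat.Base as ℕ using (ℕ; zero; suc)
import Data.Nat.Properties as ℕ
open import Data.Product.Base using (Σ-syntax; ∃; ∃-syntax; _×_; _,_; proj₁; proj₂; swap)
open import Data.Rational.Base as ℚ using (ℚ; 0ℚ)
import Data.Rational.Properties as ℚ
open import Data.Sum.Base using (_⊎_; inj₁; inj₂; [_,_]′)
open import Data.Vec.Functional using (Vector)
open import Function.Base using (_∘_; id)
open import Function.Bundles using (Equivalence)
open import Relation.Binary.Bundles using (Poset)
open import Relation.Binary.Definitions using (tri<; tri≈; tri>)
import Relation.Binary.Construct.NonStrictToStrict as ToStrict
open import Relation.Binary.PropositionalEquality using (_≡_; refl; sym; trans; cong; cong₂; subst)
import Relation.Binary.Reasoning.PartialOrder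
open import Relation.Nullary using (¬_; yes; no; does)
open import Relation.Unary using (Pred)
open import Defs

-- Enumerations of pairs and of the rationals.

unpair : ℕ → ℕ × ℕ
unpair zero = 0 , 0
unpair (suc n) with unpair n
... | m , suc k = suc m , k
... | m , zero  = 0 , suc m

-- `unpair` walks along each antidiagonal from `(0 , s)` to `(s , 0)` and then jumps to the next.
-- `go` inducts on the diagonal and then on the first coordinate: `next` is a move along a diagonal,
-- `wrap` the jump.
unpair-surjective : ∀ m k → ∃[ n ] unpair n ≡ (m , k)
unpair-surjective m k = go (m ℕ.+ k) m k refl
  where
  next : ∀ {p} → (∃[ n ] unpair n ≡ (proj₁ p , suc (proj₂ p))) → ∃[ n ] unpair n ≡ (suc (proj₁ p) , proj₂ p)
  next (n , e) = suc n , step n e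
    where
    step : ∀ n {m k} → unpair n ≡ (m , suc k) → unpair (suc n) ≡ (suc m , k)
    step n e rewrite e = refl
  wrap : ∀ {m} → (∃[ n ] unpair n ≡ (m , 0)) → ∃[ n ] unpair n ≡ (0 , suc m)
  wrap (n , e) = suc n , step n e
    where
    step : ∀ n {m} → unpair n ≡ (m , 0) → unpair (suc n) ≡ (0 , suc m)
    step n e rewrite e = refl
  go : ∀ s m k → m ℕ.+ k ≡ s → ∃[ n ] unpair n ≡ (m , k)
  go zero    zero    zero    e = 0 , refl
  go (suc s) zero    (suc k) refl = wrap (go k k 0 (ℕ.+-identityʳ k))
  go s       (suc m) k       e = next (go s m (suc k) (trans (ℕ.+-suc m k) e))

-- Integers are coded as differences of naturals, so rationals recur; surjectivity is all that is
-- asked of the enumeration.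
enumℚ : ℕ → ℚ
enumℚ n with unpair n
... | m , k with unpair m
...   | i , j = (ℤ.+ i ℤ.- ℤ.+ j) ℚ./ suc k

enumℚ-surjective : ∀ p → ∃[ n ] enumℚ n ≡ p
enumℚ-surjective p = let i , j , e = difference (ℚ.↥ p)
                         m , em′ = unpair-surjective i j
                         n , en = unpair-surjective m (ℚ.denominator-1 p)
                     in n , trans (value n en em′) (trans (cong (ℚ._/ ℚ.↧ₙ p) e) (ℚ.↥p/↧p≡p p))
  where
  difference : ∀ z → ∃[ i ] ∃[ j ] ℤ.+ i ℤ.- ℤ.+ j ≡ z
  difference (ℤ.+ n)      = n , 0 , cong ℤ.+_ (ℕ.+-identityʳ n)
  difference ℤ.-[1+ n ]   = 0 , suc n , refl
  value : ∀ n {m k i j} → unpair n ≡ (m , k) → unpair m ≡ (i , j) → enumℚ n ≡ (ℤ.+ i ℤ.- ℤ.+ j) ℚ./ suc k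
  value n en em rewrite en | em = refl

enumℚ² : ℕ → ℚ × ℚ
enumℚ² n = let m , k = unpair n in enumℚ m , enumℚ k

enumℚ²-surjective : ∀ p → ∃[ n ] enumℚ² n ≡ p
enumℚ²-surjective (p , q) = let m , e = enumℚ-surjective p
                                k , e′ = enumℚ-surjective q
                                n , e″ = unpair-surjective m k
                            in n , trans (cong (λ (m , k) → enumℚ m , enumℚ k) e″) (cong₂ _,_ e e′)

module Analysis (em : {a : Level} → ExcludedMiddle a) (R : CompleteOrderedField) where

  open CompleteOrderedField R
  open Theory em R
  open import Algebra.Properties.AbelianGroup +-abelianGroup
    using (//-rightDividesˡ; //-rightDividesʳ; ∙-cancelʳ; ⁻¹-∙-comm; ε⁻¹≈ε)
  open import Algebra.Properties.Monoid.Sum +-monoid using (sum-cong-≋)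
  open import Algebra.Properties.Ring ring using (-‿distribˡ-*; [y-z]x≈yx-zx)

  private
    variable
      a p q ℓ ℓ′ : Level

  -- Ordered fields

  ≤-poset : Poset 0ℓ 0ℓ 0ℓ
  ≤-poset = record { isPartialOrder = ≤.isPartialOrder }

  module ≤-Reasoning = Relation.Binary.Reasoning.PartialOrder ≤-poset
  open ≤-Reasoning

  ≰⇒> : ∀ {x y} → ¬ (x ≤ y) → y < x
  ≰⇒> = ToStrict.≰⇒> _≈_ _≤_ Eq.sym ≤.reflexive ≤.total

  <∨≥ : ∀ x y → x < y ⊎ y ≤ x
  <∨≥ x y with em {P = y ≤ x}
  ... | yes y≤x = inj₂ y≤x
  ... | no  y≰x = inj₁ (≰⇒> y≰x)

  ≮⇒≥ : ∀ {x y} → ¬ (x < y) → y ≤ x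
  ≮⇒≥ {x} {y} x≮y = [ ⊥-elim ∘ x≮y , id ]′ (<∨≥ x y)

  <⇒≱ : ∀ {x y} → x < y → ¬ (y ≤ x)
  <⇒≱ (x≤y , x≉y) y≤x = x≉y (≤.antisym x≤y y≤x)

  <-≤-trans : ∀ {x y z} → x < y → y ≤ z → x < z
  <-≤-trans x<y y≤z = begin-strict _ <⟨ x<y ⟩ _ ≤⟨ y≤z ⟩ _ ∎

  +-monoʳ-≤ : ∀ z {x y} → x ≤ y → z + x ≤ z + y
  +-monoʳ-≤ z x≤y = ≤-resp (+-comm _ z) (+-comm _ z) (+-monoˡ-≤ z x≤y)

  +-mono-≤ : ∀ {x y u v} → x ≤ y → u ≤ v → x + u ≤ y + v
  +-mono-≤ x≤y u≤v = ≤.trans (+-monoˡ-≤ _ x≤y) (+-monoʳ-≤ _ u≤v)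

  +-monoˡ-< : ∀ z {x y} → x < y → x + z < y + z
  +-monoˡ-< z (x≤y , x≉y) = +-monoˡ-≤ z x≤y , λ e → x≉y (∙-cancelʳ z _ _ e)

  +-nonneg : ∀ {x y} → 0# ≤ x → 0# ≤ y → 0# ≤ x + y
  +-nonneg 0≤x 0≤y = ≤-resp (+-identityˡ 0#) Eq.refl (+-mono-≤ 0≤x 0≤y)

  +-cancelʳ-≤ : ∀ z {x y} → x + z ≤ y + z → x ≤ y
  +-cancelʳ-≤ z h = ≤-resp (//-rightDividesʳ z _) (//-rightDividesʳ z _) (+-monoˡ-≤ (- z) h)

  +-cancelʳ-< : ∀ z {x y} → x + z < y + z → x < y
  +-cancelʳ-< z h = <-resp (//-rightDividesʳ z _) (//-rightDividesʳ z _) (+-monoˡ-< (- z) h)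

  x≤x+y : ∀ {x y} → 0# ≤ y → x ≤ x + y
  x≤x+y {x} 0≤y = ≤-resp (+-identityʳ x) Eq.refl (+-monoʳ-≤ x 0≤y)

  x<x+y : ∀ {x y} → 0# < y → x < x + y
  x<x+y {x} 0<y = <-resp (+-identityˡ x) (+-comm _ x) (+-monoˡ-< x 0<y)

  x<z-y⇒x+y<z : ∀ {x y z} → x < z - y → x + y < z
  x<z-y⇒x+y<z {y = y} h = <-resp Eq.refl (//-rightDividesˡ y _) (+-monoˡ-< y h)

  x+y<z⇒x<z-y : ∀ {x y z} → x + y < z → x < z - y
  x+y<z⇒x<z-y {y = y} h = <-resp (//-rightDividesʳ y _) Eq.refl (+-monoˡ-< (- y) h)

  x-y<z⇒x<z+y : ∀ {x y z} → x - y < z → x < z + y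
  x-y<z⇒x<z+y {y = y} h = <-resp (//-rightDividesˡ y _) Eq.refl (+-monoˡ-< y h)

  x<z+y⇒x-y<z : ∀ {x y z} → x < z + y → x - y < z
  x<z+y⇒x-y<z {y = y} h = <-resp Eq.refl (//-rightDividesʳ y _) (+-monoˡ-< (- y) h)

  0<y-x : ∀ {x y} → x < y → 0# < y - x
  0<y-x {x} h = <-resp (-‿inverseʳ x) Eq.refl (+-monoˡ-< (- x) h)

  *-monoʳ-≤ : ∀ {x y} z → 0# ≤ z → x ≤ y → x * z ≤ y * z
  *-monoʳ-≤ {x} {y} z 0≤z x≤y = +-cancelʳ-≤ (- (x * z))
    (≤-resp (Eq.sym (-‿inverseʳ (x * z))) ([y-z]x≈yx-zx z y x)
      (*-nonneg (≤-resp (-‿inverseʳ x) Eq.refl (+-monoˡ-≤ (- x) x≤y)) 0≤z))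

  *-inverseʳ-cancel : ∀ {x y} → ¬ (y ≈ 0#) → (x * y) * (y ⁻¹) ≈ x
  *-inverseʳ-cancel y≉0 = Eq.trans (*-assoc _ _ _) (Eq.trans (*-congˡ (*-inverseʳ y≉0)) (*-identityʳ _))

  *-inverseˡ-cancel : ∀ {x y} → ¬ (y ≈ 0#) → (x * (y ⁻¹)) * y ≈ x
  *-inverseˡ-cancel y≉0 = Eq.trans (*-assoc _ _ _)
    (Eq.trans (*-congˡ (Eq.trans (*-comm _ _) (*-inverseʳ y≉0))) (*-identityʳ _))

  >⇒≉ : ∀ {x y} → x < y → ¬ (y ≈ x)
  >⇒≉ (_ , x≉y) y≈x = x≉y (Eq.sym y≈x)

  *-monoʳ-< : ∀ {x y} z → 0# < z → x < y → x * z < y * z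
  *-monoʳ-< z 0<z (x≤y , x≉y) = *-monoʳ-≤ z (proj₁ 0<z) x≤y , λ e →
    x≉y (Eq.trans (Eq.sym (*-inverseʳ-cancel z≉0)) (Eq.trans (*-congʳ e) (*-inverseʳ-cancel z≉0)))
    where z≉0 = >⇒≉ 0<z

  0<1 : 0# < 1#
  0<1 = 0≤1 , 0≉1

  ⁻¹-pos : ∀ {x} → 0# < x → 0# < x ⁻¹
  ⁻¹-pos {x} 0<x = ≰⇒> λ x⁻¹≤0 → <⇒≱ 0<1
    (≤-resp (Eq.trans (*-comm _ _) (*-inverseʳ (>⇒≉ 0<x))) (zeroˡ x) (*-monoʳ-≤ x (proj₁ 0<x) x⁻¹≤0))

  ι-pos : ∀ n → 0# < ι (suc n)
  ι-pos n = ι-nonneg (suc n) , ι≉0 n ∘ Eq.sym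

  -- If `x` bounded all naturals, they would have a supremum `u`. Since successors of naturals are
  -- naturals, `u - 1` would bound them too, against leastness.
  archimedean : ∀ x → ∃[ n ] x < ι n
  archimedean x with em {P = ∃[ n ] x < ι n}
  ... | yes h = h
  ... | no ¬h with complete (λ y → ∃[ n ] y ≈ ι n) (0# , 0 , Eq.refl)
                   (x , λ { (n , y≈ιn) → ≤.trans (≤.reflexive y≈ιn) (≮⇒≥ (λ h → ¬h (n , h))) })
  ...   | u , ub , least = ⊥-elim (<⇒≱ (x<x+y 0<1) (least′ (λ { (n , e) → +-cancelʳ-≤ 1#
            (≤-resp (Eq.trans (+-comm _ _) (+-congʳ (Eq.sym e))) (Eq.sym (//-rightDividesˡ 1# u)) (ub (suc n , Eq.refl))) })))
    where
    least′ : IsUpperBound (λ y → ∃[ n ] y ≈ ι n) (u - 1#) → u + 1# ≤ u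
    least′ h = ≤-resp Eq.refl (//-rightDividesˡ 1# u) (+-monoˡ-≤ 1# (least (u - 1#) h))

  ∃-small : ∀ {x} → 0# < x → ∃[ n ] (ι (suc n)) ⁻¹ < x
  ∃-small {x} 0<x with archimedean (x ⁻¹)
  ... | zero , x⁻¹<0 = ⊥-elim (<⇒≱ x⁻¹<0 (proj₁ (⁻¹-pos 0<x)))
  ... | suc n , x⁻¹<n = n , <-resp (Eq.trans (*-congʳ (Eq.trans (*-comm _ _) (*-inverseʳ (>⇒≉ 0<x)))) (*-identityˡ _))
          (Eq.trans (*-congʳ (*-comm _ _)) (*-inverseʳ-cancel (ι≉0 n)))
          (*-monoʳ-< (ι (suc n) ⁻¹) (⁻¹-pos (ι-pos n)) (*-monoʳ-< x 0<x x⁻¹<n))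

  floor : ∀ {x} → 0# ≤ x → ∃[ n ] ι n ≤ x × x < ι (suc n)
  floor {x} 0≤x = search (proj₁ (archimedean x)) (proj₂ (archimedean x))
    where
    search : ∀ n → x < ι n → ∃[ n ] ι n ≤ x × x < ι (suc n)
    search zero    h = ⊥-elim (<⇒≱ h 0≤x)
    search (suc n) h with em {P = x < ι n}
    ... | yes h′ = search n h′
    ... | no ¬h′ = n , ≮⇒≥ ¬h′ , h

  -- The rationals again, built directly from `ι` so that density can be proved without the
  -- arithmetic of `fromℚ`.
  dense : ℕ → ℝ
  dense n with unpair n
  ... | m , k with unpair m
  ...   | i , j = (ι i - ι j) * (ι (suc k) ⁻¹)

  dense-value : ∀ i j k → ∃[ n ] dense n ≡ (ι i - ι j) * (ι (suc k) ⁻¹)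
  dense-value i j k with unpair-surjective i j
  ... | m , e with unpair-surjective m k
  ...   | n , e′ = n , eq
    where
    eq : dense n ≡ (ι i - ι j) * (ι (suc k) ⁻¹)
    eq rewrite e′ | e = refl

  -- Scale by `K` with `1/K < y - x`, shift by a natural `j` to reach a nonnegative number, and let
  -- `i` be the floor of `x K + j`. Then `(i + 1 - j) / K` exceeds `x` by at most `1/K`.
  dense-between : ∀ {x y} → x < y → ∃[ n ] x < dense n × dense n < y
  dense-between {x} {y} x<y with ∃-small (0<y-x x<y)
  ... | k , 1/k<y-x with archimedean (- (x * ι (suc k)))
  ...   | j , -z<j with floor {x * ι (suc k) + ι j}
                          (≤-resp (-‿inverseʳ z) Eq.refl (+-monoʳ-≤ z (proj₁ -z<j)))
    where z = x * ι (suc k)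
  ...     | i , i≤z+j , z+j<i+1 with dense-value (suc i) j k
  ...       | n , e = n , subst (x <_) (sym e) lower , subst (_< y) (sym e) upper
    where
    K = ι (suc k)
    z = x * K
    w = (ι (suc i) - ι j) * (K ⁻¹)
    wK : w * K ≈ ι (suc i) - ι j
    wK = *-inverseˡ-cancel (ι≉0 k)
    scale-cancel : ∀ {u v} → u * K < v * K → u < v
    scale-cancel h = <-resp (*-inverseʳ-cancel (ι≉0 k)) (*-inverseʳ-cancel (ι≉0 k)) (*-monoʳ-< (K ⁻¹) (⁻¹-pos (ι-pos k)) h)
    1+z<yK : 1# + z < y * K
    1+z<yK = begin-strict
      1# + x * K            ≈⟨ +-congʳ (Eq.trans (*-comm _ _) (*-inverseʳ (ι≉0 k))) ⟨
      (K ⁻¹) * K + x * K    ≈⟨ distribʳ K _ _ ⟨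
      ((K ⁻¹) + x) * K      <⟨ *-monoʳ-< K (ι-pos k) (x<z-y⇒x+y<z 1/k<y-x) ⟩
      y * K                 ∎
    lower : x < w
    lower = scale-cancel (<-resp Eq.refl (Eq.sym wK) (x+y<z⇒x<z-y z+j<i+1))
    upper : w < y
    upper = scale-cancel (<-resp (Eq.sym wK) Eq.refl (x<z+y⇒x-y<z (begin-strict
      1# + ι i          ≤⟨ +-monoʳ-≤ 1# i≤z+j ⟩
      1# + (z + ι j)    ≈⟨ +-assoc _ _ _ ⟨
      1# + z + ι j      <⟨ +-monoˡ-< (ι j) 1+z<yK ⟩
      y * K + ι j       ∎)))

  <+⇒split : ∀ {c x y} → c < x + y → ∃[ n ] dense n < x × c - dense n < y
  <+⇒split {c} {x} {y} h = let n , l , u = dense-between {c - y} {x} (x<z+y⇒x-y<z h) in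
    n , u , x<z+y⇒x-y<z (<-resp Eq.refl (+-comm (dense n) y) (x-y<z⇒x<z+y l))

  split⇒<+ : ∀ {c x y} d → d < x → c - d < y → c < x + y
  split⇒<+ {c} {x} {y} d d<x h = <-resp Eq.refl (+-comm y x)
    (<-≤-trans (x-y<z⇒x<z+y h) (+-monoʳ-≤ y (proj₁ d<x)))

  +<⇒split : ∀ {c x y z} → x + y ≈ z → c < y → ∃[ n ] x ≤ dense n × c + dense n < z
  +<⇒split {c} {x} {y} {z} e h = let n , l , u = dense-between {x} {z - c} (x+y<z⇒x<z-y
                                       (<-resp (+-comm c x) (Eq.trans (+-comm y x) e) (+-monoˡ-< x h))) in
    n , proj₁ l , <-resp (+-comm (dense n) c) Eq.refl (x<z-y⇒x+y<z u)

  split⇒+< : ∀ {c x y z} → x + y ≈ z → ∀ d → x ≤ d → c + d < z → c < y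
  split⇒+< {c} {x} {y} {z} e d x≤d h = +-cancelʳ-< d (<-≤-trans h (≤-resp e (+-comm d y) (+-monoˡ-≤ y x≤d)))

  -- Measurable predicates

  -- Predicates of any level replace Boolean sets, so that the closure properties of a σ-algebra
  -- become closure under connectives and countable quantifiers.
  Meas : (X : MeasurableSpace ℓ) → Pred (Point X) p → Set ℓ
  Meas X P = Measurable X (comprehend P)

  module _ {X : Set a} (A : Pow X) where
    comprehend-∈ : comprehend (_∈ A) ≐ A
    comprehend-∈ x = bool-ext em-T T-em

  module _ (X : MeasurableSpace ℓ) where

    measurable⇒meas : ∀ {A} → Measurable X A → Meas X (_∈ A)
    measurable⇒meas {A} = ≐-measurable X (λ x → sym (comprehend-∈ A x))

    meas⇒measurable : ∀ {A} → Meas X (_∈ A) → Measurable X A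
    meas⇒measurable {A} = ≐-measurable X (comprehend-∈ A)

    module _ {P : Pred (Point X) p} {Q : Pred (Point X) q} where
      meas-resp : (∀ x → P x → Q x) → (∀ x → Q x → P x) → Meas X P → Meas X Q
      meas-resp f g = ≐-measurable X (λ x → does-cong (f x) (g x))

    meas-¬ : {P : Pred (Point X) p} → Meas X P → Meas X (λ x → ¬ P x)
    meas-¬ {P = P} m = ≐-measurable X (λ x → not-does x) (∁-measurable X m)
      where
      not-does : ∀ x → not (comprehend P x) ≡ comprehend (λ x → ¬ P x) x
      not-does x with em {P = P x} | em {P = ¬ P x}
      ... | yes p | yes ¬p = ⊥-elim (¬p p)
      ... | yes p | no _   = refl
      ... | no _  | yes _  = refl
      ... | no ¬p | no ¬¬p = ⊥-elim (¬¬p ¬p)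

    meas-∃ : {P : ℕ → Pred (Point X) p} → (∀ n → Meas X (P n)) → Meas X (λ x → ∃[ n ] P n x)
    meas-∃ m = ≐-measurable X (λ x → does-cong (λ (n , t) → n , em-T t) (λ (n , t) → n , T-em t)) (⋃-measurable X m)

    meas-∀ : {P : ℕ → Pred (Point X) p} → (∀ n → Meas X (P n)) → Meas X (λ x → ∀ n → P n x)
    meas-∀ {P = P} m = meas-resp
      (λ x h n → ¬¬-elim (λ ¬p → h (n , ¬p))) (λ x h (n , ¬p) → ¬p (h n)) (meas-¬ (meas-∃ (λ n → meas-¬ (m n))))
      where
      ¬¬-elim : ∀ {n x} → ¬ ¬ P n x → P n x
      ¬¬-elim {n} {x} h with em {P = P n x}
      ... | yes p = p
      ... | no ¬p = ⊥-elim (h ¬p)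

    meas-∀-enumerated : ∀ {i} {I : Set i} (e : ℕ → I) → (∀ x → ∃[ n ] e n ≡ x) →
      {P : I → Pred (Point X) p} → (∀ i → Meas X (P i)) → Meas X (λ x → ∀ i → P i x)
    meas-∀-enumerated e surj {P} m = meas-resp
      (λ x h i → subst (λ i → P i x) (proj₂ (surj i)) (h (proj₁ (surj i)))) (λ x h n → h (e n)) (meas-∀ (m ∘ e))

    meas-const : (P : Set p) → Meas X (λ _ → P)
    meas-const P with em {P = P}
    ... | yes _ = ≐-measurable X (λ _ → refl) (∁-measurable X (∅-measurable X))
    ... | no _  = ≐-measurable X (λ _ → refl) (∅-measurable X)

    meas-⊎ : {P Q : Pred (Point X) p} → Meas X P → Meas X Q → Meas X (λ x → P x ⊎ Q x)
    meas-⊎ {p = p} {P} {Q} mP mQ = meas-resp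
      (λ { x (zero , h) → inj₁ h ; x (suc _ , h) → inj₂ h })
      (λ { x (inj₁ h) → 0 , h ; x (inj₂ h) → 1 , h }) (meas-∃ {P = family′} λ { zero → mP ; (suc _) → mQ })
      where
      family′ : ℕ → Pred (Point X) p
      family′ zero    = P
      family′ (suc _) = Q

    meas-× : {P Q : Pred (Point X) p} → Meas X P → Meas X Q → Meas X (λ x → P x × Q x)
    meas-× {p = p} {P} {Q} mP mQ = meas-resp
      (λ x h → h 0 , h 1) (λ { x (p , q) zero → p ; x (p , q) (suc _) → q }) (meas-∀ {P = family′} λ { zero → mP ; (suc _) → mQ })
      where
      family′ : ℕ → Pred (Point X) p
      family′ zero    = P
      family′ (suc _) = Q

    -- The guard does not depend on the point and is decided once, so measurability of `P` is owed
    -- only when `Z` holds. Later guards confine parameters to the unit interval.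
    meas-guard : {Z : Set q} {P : Pred (Point X) p} → (Z → Meas X P) → Meas X (λ x → Z × P x)
    meas-guard {Z = Z} m with em {P = Z}
    ... | yes z = meas-resp (λ x p → z , p) (λ x → proj₂) (m z)
    ... | no ¬z = meas-resp (λ x z → ⊥-elim (¬z z)) (λ x → proj₁) (meas-const Z)

    meas-→ : {Z : Set q} {P : Pred (Point X) p} → (Z → Meas X P) → Meas X (λ x → Z → P x)
    meas-→ {Z = Z} m with em {P = Z}
    ... | yes z = meas-resp (λ x p _ → p) (λ x f → f z) (m z)
    ... | no ¬z = meas-resp (λ x _ z → ⊥-elim (¬z z)) (λ x _ → ¬z) (meas-const (¬ Z))

  -- Preimages and sections.

  fullᴱ : (X : MeasurableSpace ℓ) → Event X
  fullᴱ X = ∁ ∅ , ∁-measurable X (∅-measurable X)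

  -- Preimages commute with complements and countable unions, so the generators decide.
  preimage : (Z : MeasurableSpace ℓ) {X : Set ℓ′} {𝒢 : Pred (Pow X) ℓ′} (φ : Point Z → X) →
    (∀ A → 𝒢 A → Measurable Z (A ∘ φ)) → ∀ {A} → Generated 𝒢 A → Measurable Z (A ∘ φ)
  preimage Z φ g (gen h)      = g _ h
  preimage Z φ g (resp e m)   = ≐-measurable Z (e ∘ φ) (preimage Z φ g m)
  preimage Z φ g empty        = ∅-measurable Z
  preimage Z φ g (compl m)    = ∁-measurable Z (preimage Z φ g m)
  preimage Z φ g (countUni m) = ⋃-measurable Z (λ n → preimage Z φ g (m n))

  module _ (X : MeasurableSpace ℓ) (Y : MeasurableSpace ℓ′) where

    swap-measurable : ∀ {K} → Measurable (X ⊗ Y) K → Measurable (Y ⊗ X) (K ∘ swap)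
    swap-measurable = preimage (Y ⊗ X) swap λ { C (A , B , e) → gen (B , A , λ (y , x) → trans (e (x , y)) (∧-comm (proj₁ A x) _)) }

    -- A section is a preimage under `y ↦ (x , y)`. For a rectangle it is `B` or empty, according to
    -- whether `x` lies in `A`.
    sectionˡ : ∀ {K} → Measurable (X ⊗ Y) K → ∀ x → Measurable Y (λ y → K (x , y))
    sectionˡ m x = preimage Y (x ,_) (λ { C (A , B , e) → meas⇒measurable Y (meas-resp Y
      (λ y (tA , tB) → subst T (sym (e (x , y))) (Equivalence.from T-∧ (tA , tB)))
      (λ y t → Equivalence.to T-∧ (subst T (e (x , y)) t))
      (meas-guard Y {Z = x ∈ proj₁ A} (λ _ → measurable⇒meas Y (proj₂ B)))) }) m

    meas-proj₁ : {P : Pred (Point X) p} → Meas X P → Meas (X ⊗ Y) (P ∘ proj₁)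
    meas-proj₁ m = resp (λ { (x , y) → bool-ext (proj₁ ∘ Equivalence.to T-∧) (λ t → Equivalence.from T-∧ (t , _)) })
      (gen ((_ , m) , fullᴱ Y , λ _ → refl))

    meas-proj₂ : {P : Pred (Point Y) p} → Meas Y P → Meas (X ⊗ Y) (P ∘ proj₂)
    meas-proj₂ m = resp (λ { (x , y) → refl })
      (gen (fullᴱ X , (_ , m) , λ _ → refl))

  sectionʳ : (X : MeasurableSpace ℓ) (Y : MeasurableSpace ℓ′) →
    ∀ {K} → Measurable (X ⊗ Y) K → ∀ y → Measurable X (λ x → K (x , y))
  sectionʳ X Y m = sectionˡ Y X (swap-measurable X Y m)

  -- The π-λ theorem.

  data Dynkin {X : Set ℓ} (𝒢 : Pred (Pow X) ℓ) : Pred (Pow X) ℓ where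
    gen     : ∀ {A} → 𝒢 A → Dynkin 𝒢 A
    resp    : ∀ {A B} → A ≐ B → Dynkin 𝒢 A → Dynkin 𝒢 B
    empty   : Dynkin 𝒢 ∅
    compl   : ∀ {A} → Dynkin 𝒢 A → Dynkin 𝒢 (∁ A)
    disjUni : ∀ {A} → Disjoint A → (∀ n → Dynkin 𝒢 (A n)) → Dynkin 𝒢 (⋃ A)

  infixr 7 _∩_
  _∩_ : {X : Set a} → Pow X → Pow X → Pow X
  (A ∩ B) x = A x ∧ B x

  intersect : (X : MeasurableSpace ℓ) → Event X → Event X → Event X
  intersect X (A , mA) (B , mB) = A ∩ B , ≐-measurable X
    (λ x → bool-ext (λ t → Equivalence.from T-∧ (em-T {P = (x ∈ A) × (x ∈ B)} t)) (λ t → T-em (Equivalence.to T-∧ t)))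
    (meas-× X (measurable⇒meas X mA) (measurable⇒meas X mB))

  pair : {X : Set a} → Pow X → Pow X → ℕ → Pow X
  pair A B zero          = A
  pair A B (suc zero)    = B
  pair A B (suc (suc _)) = ∅

  pair-disjoint : {X : Set a} {A B : Pow X} → (∀ x → x ∈ A → ¬ (x ∈ B)) → Disjoint (pair A B)
  pair-disjoint d zero          zero          m≢n x s t = m≢n refl
  pair-disjoint d zero          (suc zero)    m≢n x s t = d x s t
  pair-disjoint d (suc zero)    zero          m≢n x s t = d x t s
  pair-disjoint d (suc zero)    (suc zero)    m≢n x s t = m≢n refl
  pair-disjoint d zero          (suc (suc n)) m≢n x s ()
  pair-disjoint d (suc zero)    (suc (suc n)) m≢n x s ()
  pair-disjoint d (suc (suc m)) n             m≢n x () t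

  ⋃-pair : {X : Set a} (A B : Pow X) → ⋃ (pair A B) ≐ A ∪ B
  ⋃-pair A B x = bool-ext
    (λ t → Equivalence.from T-∨ (from (em-T t)))
    (λ t → T-em (to (Equivalence.to T-∨ t)))
    where
    to : x ∈ A ⊎ x ∈ B → ∃[ n ] x ∈ pair A B n
    to (inj₁ a) = 0 , a
    to (inj₂ b) = 1 , b
    from : ∃[ n ] x ∈ pair A B n → x ∈ A ⊎ x ∈ B
    from (zero , a)     = inj₁ a
    from (suc zero , b) = inj₂ b

  T-not : ∀ {x} → ¬ T x → T (not x)
  T-not {false} h = _
  T-not {true}  h = h _

  not-T : ∀ {x} → T (not x) → ¬ T x
  not-T {false} _ ()
  not-T {true}  ()

  module PiLambda {X : Set ℓ} {𝒢 : Pred (Pow X) ℓ}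
    (∩-closed : ∀ {A B} → 𝒢 A → 𝒢 B → Dynkin 𝒢 (A ∩ B)) where

    private 𝒟 = Dynkin 𝒢

    -- The difference is the complement of the disjoint union of `∁ A` and `A ∩ B`.
    dynkin-∖ : ∀ {A B} → 𝒟 A → 𝒟 (A ∩ B) → 𝒟 (A ∩ ∁ B)
    dynkin-∖ {A} {B} dA dAB = resp eq (compl (resp (⋃-pair (∁ A) (A ∩ B)) (disjUni
      (pair-disjoint (λ x t s → not-T t (proj₁ (Equivalence.to T-∧ s))))
      λ { zero → compl dA ; (suc zero) → dAB ; (suc (suc _)) → empty })))
      where
      eq : ∁ (∁ A ∪ (A ∩ B)) ≐ A ∩ ∁ B
      eq x with A x
      ... | true  = refl
      ... | false = refl

    -- For fixed `A`, the sets whose intersection with `A` stays in the class form a λ-system, so it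
    -- is enough to test generators.
    dynkin-∩ : ∀ {A B} → 𝒟 A → (∀ {C} → 𝒢 C → 𝒟 (A ∩ C)) → 𝒟 B → 𝒟 (A ∩ B)
    dynkin-∩ dA h (gen g)     = h g
    dynkin-∩ {A} dA h (resp e d) = resp (λ x → cong (A x ∧_) (e x)) (dynkin-∩ dA h d)
    dynkin-∩ {A} dA h empty   = resp (λ x → sym (∧-zeroʳ (A x))) empty
    dynkin-∩ dA h (compl d)   = dynkin-∖ dA (dynkin-∩ dA h d)
    dynkin-∩ {A} dA h (disjUni {B} dis d) = resp
      (λ x → bool-ext
        (λ t → let n , s = em-T {P = ∃[ n ] x ∈ A ∩ B n} t ; a , b = Equivalence.to T-∧ s in
          Equivalence.from T-∧ (a , T-em (n , b)))
        (λ t → let a , s = Equivalence.to T-∧ t ; n , b = em-T {P = ∃[ n ] x ∈ B n} s in T-em (n , Equivalence.from T-∧ (a , b))))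
      (disjUni {A = λ n → A ∩ B n}
        (λ m n m≢n x s t → dis m n m≢n x (proj₂ (Equivalence.to T-∧ s)) (proj₂ (Equivalence.to T-∧ t)))
        (λ n → dynkin-∩ dA h (d n)))

    -- `dynkin-∩` is used twice: with a generator `C` fixed, it provides what its use with `A` fixed
    -- demands of generators.
    dynkin-inter : ∀ {A B} → 𝒟 A → 𝒟 B → 𝒟 (A ∩ B)
    dynkin-inter {A} dA = dynkin-∩ dA λ {C} g →
      resp (λ x → ∧-comm (C x) (A x)) (dynkin-∩ (gen g) (∩-closed g) dA)

    -- The union of `A 0`, ..., `A (n - 1)`, written by De Morgan because complements and
    -- intersections are the operations available so far.
    before : (ℕ → Pow X) → ℕ → Pow X
    before A zero    = ∅
    before A (suc n) = ∁ (∁ (before A n) ∩ ∁ (A n))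

    -- Each set is cut down to the points not met earlier. This makes the family disjoint and keeps
    -- its union, since every point has a first index.
    dynkin-⋃ : ∀ {A} → (∀ n → 𝒟 (A n)) → 𝒟 (⋃ A)
    dynkin-⋃ {A} d = resp (λ x → does-cong
        (λ (n , t) → n , proj₁ (Equivalence.to T-∧ t)) (λ (n , t) → first n t))
      (disjUni {A = λ n → A n ∩ ∁ (before A n)} disjoint (λ n → dynkin-inter (d n) (compl (dynkin-before n))))
      where
      dynkin-before : ∀ n → 𝒟 (before A n)
      dynkin-before zero    = empty
      dynkin-before (suc n) = compl (dynkin-inter (compl (dynkin-before n)) (compl (d n)))

      now : ∀ {x} n → x ∈ A n → x ∈ before A (suc n)
      now n t = T-not λ s → not-T (proj₂ (Equivalence.to T-∧ s)) t

      earlier : ∀ {x} n → x ∈ before A n → x ∈ before A (suc n)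
      earlier n t = T-not λ s → not-T (proj₁ (Equivalence.to T-∧ s)) t

      before-≤ : ∀ {x m n} → m ℕ.<′ n → x ∈ A m → x ∈ before A n
      before-≤ (ℕ.≤′-reflexive refl) t = now _ t
      before-≤ (ℕ.≤′-step m<n)       t = earlier _ (before-≤ m<n t)

      disjoint : Disjoint (λ n → A n ∩ ∁ (before A n))
      disjoint m n m≢n x s t with ℕ.<-cmp m n
      ... | tri< m<n _ _ = not-T (proj₂ (Equivalence.to T-∧ t)) (before-≤ (ℕ.<⇒<′ m<n) (proj₁ (Equivalence.to T-∧ s)))
      ... | tri≈ _ m≡n _ = m≢n m≡n
      ... | tri> _ _ n<m = not-T (proj₂ (Equivalence.to T-∧ s)) (before-≤ (ℕ.<⇒<′ n<m) (proj₁ (Equivalence.to T-∧ t)))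

      first : ∀ {x} n → x ∈ A n → ∃[ m ] x ∈ A m ∩ ∁ (before A m)
      fromBefore : ∀ {x} n → x ∈ before A n → ∃[ m ] x ∈ A m ∩ ∁ (before A m)
      fromBefore {x} (suc n) t with before A n x in e | A n x in e′
      ... | true  | _    = fromBefore n (subst T (sym e) _)
      ... | false | true = n , Equivalence.from T-∧ (subst T (sym e′) _ , T-not (λ s → subst T e s))
      first {x} n t with before A n x in e
      ... | true  = fromBefore n (subst T (sym e) _)
      ... | false = n , Equivalence.from T-∧ (t , T-not (λ s → subst T e s))

    generated⇒dynkin : ∀ {A} → Generated 𝒢 A → 𝒟 A
    generated⇒dynkin (gen g)      = gen g
    generated⇒dynkin (resp e m)   = resp e (generated⇒dynkin m)
    generated⇒dynkin empty        = empty
    generated⇒dynkin (compl m)    = compl (generated⇒dynkin m)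
    generated⇒dynkin (countUni m) = dynkin-⋃ (λ n → generated⇒dynkin (m n))

  -- Measurable functions

  below-measurable : ∀ r → Meas unitInterval (λ q → proj₁ q < r)
  below-measurable r = gen λ q t → let q<r = em-T {P = proj₁ q < r} t in
    r - proj₁ q , 0<y-x q<r , λ y _ y< → T-em (<-resp Eq.refl
      (Eq.trans (+-comm _ _) (//-rightDividesˡ (proj₁ q) r)) y<)

  module _ (X : MeasurableSpace ℓ) where

    <-measurable-resp : ∀ {f g} → (∀ x → f x ≈ g x) → MeasurableFn X f → MeasurableFn X g
    <-measurable-resp e m c = meas-resp X (λ x → <-resp Eq.refl (e x)) (λ x → <-resp Eq.refl (Eq.sym (e x))) (m c)

    ≤-measurable : ∀ {f} → MeasurableFn X f → ∀ c → Meas X (λ x → f x ≤ c)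
    ≤-measurable m c = meas-resp X (λ x → ≮⇒≥) (λ x h l → <⇒≱ l h) (meas-¬ X (m c))

    const-measurable : ∀ r → MeasurableFn X (λ _ → r)
    const-measurable r c = meas-const X (c < r)

    +-measurable : ∀ {f g} → MeasurableFn X f → MeasurableFn X g → MeasurableFn X (λ x → f x + g x)
    +-measurable {f} {g} mf mg c = meas-resp X
      {P = λ x → ∃[ n ] dense n < f x × c - dense n < g x} {Q = λ x → c < f x + g x}
      (λ { x (n , l , u) → split⇒<+ (dense n) l u }) (λ x → <+⇒split)
      (meas-∃ X λ n → meas-× X (mf (dense n)) (mg (c - dense n)))

    -- The difference is given by an equation because this is the form in which additivity delivers
    -- the measure of a complement.
    ∸-measurable : ∀ {f g h} → MeasurableFn X f → MeasurableFn X h → (∀ x → f x + g x ≈ h x) → MeasurableFn X g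
    ∸-measurable {f} {g} {h} mf mh e c = meas-resp X
      {P = λ x → ∃[ n ] f x ≤ dense n × c + dense n < h x} {Q = λ x → c < g x}
      (λ { x (n , l , u) → split⇒+< (e x) (dense n) l u }) (λ x → +<⇒split (e x))
      (meas-∃ X λ n → meas-× X (≤-measurable mf (dense n)) (mh (c + dense n)))

    ∑-measurable : ∀ n {f : ℕ → Point X → ℝ} → (∀ i → MeasurableFn X (f i)) → MeasurableFn X (λ x → ∑ n (λ i → f i x))
    ∑-measurable zero    m = const-measurable 0#
    ∑-measurable (suc n) m = +-measurable (m 0) (∑-measurable n (m ∘ suc))

    sup-measurable : ∀ {f : ℕ → Point X → ℝ} {g} → (∀ n → MeasurableFn X (f n)) →
      (∀ x → IsSup (λ y → ∃[ n ] y ≈ f n x) (g x)) → MeasurableFn X g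
    sup-measurable {f} {g} m sup c = meas-resp X
      (λ x (n , c<f) → <-≤-trans c<f (proj₁ (sup x) (n , Eq.refl)))
      below
      (meas-∃ X λ n → m n c)
      where
      below : ∀ x → c < g x → ∃[ n ] c < f n x
      below x c<g with em {P = ∃[ n ] c < f n x}
      ... | yes h = h
      ... | no ¬h = ⊥-elim (<⇒≱ c<g (proj₂ (sup x) c λ { (n , e) → ≤.trans (≤.reflexive e) (≮⇒≥ λ l → ¬h (n , l)) }))

    *-measurable : ∀ {r f} → 0# < r → MeasurableFn X f → MeasurableFn X (λ x → f x * r)
    *-measurable {r} 0<r m c = meas-resp X
      (λ x h → <-resp (*-inverseˡ-cancel r≉0) Eq.refl (*-monoʳ-< r 0<r h))
      (λ x h → <-resp Eq.refl (*-inverseʳ-cancel r≉0) (*-monoʳ-< (r ⁻¹) (⁻¹-pos 0<r) h))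
      (m (c * (r ⁻¹)))
      where r≉0 = >⇒≉ 0<r

    if-measurable : ∀ {A f} → Measurable X A → MeasurableFn X f → MeasurableFn X (λ x → if A x then f x else 0#)
    if-measurable {A} {f} mA m c = meas-resp X (λ x → to (A x)) (λ x → from (A x))
      (meas-⊎ X (meas-× X (measurable⇒meas X mA) (m c))
                (meas-× X (meas-¬ X (measurable⇒meas X mA)) (meas-const X (c < 0#))))
      where
      to : ∀ b {y} → (T b × c < y) ⊎ (¬ T b × c < 0#) → c < (if b then y else 0#)
      to true  (inj₁ (_ , h)) = h
      to true  (inj₂ (n , _)) = ⊥-elim (n _)
      to false (inj₂ (_ , h)) = h
      from : ∀ b {y} → c < (if b then y else 0#) → (T b × c < y) ⊎ (¬ T b × c < 0#)
      from true  h = inj₁ (_ , h)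
      from false h = inj₂ (id , h)

    -- A dense value between `q` and `f x` splits the condition into one on `q` and one on `x`,
    -- giving a countable union of rectangles.
    hypograph-measurable : ∀ {f} → MeasurableFn X f → Meas (X ⊗ unitInterval) (λ (x , q) → proj₁ q < f x)
    hypograph-measurable {f} m = meas-resp (X ⊗ unitInterval)
      (λ (x , q) (n , q<d , d<f) → <-≤-trans q<d (proj₁ d<f)) (λ (x , q) → dense-between)
      (meas-∃ (X ⊗ unitInterval) λ n → meas-× (X ⊗ unitInterval)
        (meas-proj₂ X unitInterval (below-measurable (dense n)))
        (meas-proj₁ X unitInterval (m (dense n))))

  -- Measures of unions and of sections.

  module _ {X : MeasurableSpace ℓ} (ν : SubProb X) where

    private
      module ν = SubProb ν

    -- Countable additivity for the sequence `A`, `B` padded with empty sets: the partial sum of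
    -- length two is the largest one.
    μ-union : ∀ (A B C : Event X) → (∀ x → x ∈ proj₁ A → ¬ (x ∈ proj₁ B)) →
      proj₁ A ∪ proj₁ B ≐ proj₁ C → ν.μ A + ν.μ B ≈ ν.μ C
    μ-union A B C dis e = Eq.trans (≤.antisym upper lower) (ν.μ-cong (⋃ᴱ {X = X} seq) C (λ x → trans (⋃-pair (proj₁ A) (proj₁ B) x) (e x)))
      where
      seq : ℕ → Event X
      seq n = pair (proj₁ A) (proj₁ B) n , measurable n
        where
        measurable : ∀ n → Measurable X (pair (proj₁ A) (proj₁ B) n)
        measurable zero          = proj₂ A
        measurable (suc zero)    = proj₂ B
        measurable (suc (suc n)) = ∅-measurable X
      series : IsSeriesSum (ν.μ ∘ seq) (ν.μ (⋃ᴱ {X = X} seq))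
      series = ν.μ-additive seq (λ { m n → pair-disjoint dis m n })
      upper : ν.μ A + ν.μ B ≤ ν.μ (⋃ᴱ {X = X} seq)
      upper = ≤.trans (≤.reflexive (+-congˡ (Eq.sym (+-identityʳ _)))) (proj₁ series (2 , Eq.refl))
      zeros : ∀ n → ∑ n (λ i → ν.μ (seq (suc (suc i)))) ≈ 0#
      zeros zero    = Eq.refl
      zeros (suc n) = Eq.trans (+-cong ν.μ-empty (zeros n)) (+-identityˡ 0#)
      lower : ν.μ (⋃ᴱ {X = X} seq) ≤ ν.μ A + ν.μ B
      lower = proj₂ series _ λ
        { (zero , e)        → ≤.trans (≤.reflexive e) (+-nonneg (ν.μ-nonneg A) (ν.μ-nonneg B))
        ; (suc zero , e)    → ≤.trans (≤.reflexive e) (+-monoʳ-≤ (ν.μ A) (ν.μ-nonneg B))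
        ; (suc (suc n) , e) → ≤.reflexive (Eq.trans e (+-congˡ (Eq.trans (+-congˡ (zeros n)) (+-identityʳ _)))) }

  module _ (X : MeasurableSpace ℓ) (Y : MeasurableSpace ℓ′) where

    MeasurableSections : Pow (Point X × Point Y) → Set (ℓ ⊔ ℓ′)
    MeasurableSections K = Σ[ m ∈ (∀ y → Measurable X (λ x → K (x , y))) ]
      MeasurableFn (Sub X ⊗ Y) (λ (ν , y) → μ ν ((λ x → K (x , y)) , m y))

    private
      μ-measurable : ∀ A → MeasurableFn (Sub X ⊗ Y) (λ (ν , y) → μ ν A)
      μ-measurable A c = meas-proj₁ (Sub X) Y (gen (A , c , λ _ → refl))

    rectangle-sections : ∀ {C} (A : Event X) (B : Event Y) → C ≐ (λ (x , y) → proj₁ A x ∧ proj₁ B y) → MeasurableSections C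
    rectangle-sections {C} A B e = section ,
      <-measurable-resp (Sub X ⊗ Y) (λ (ν , y) → value ν (_ , section y) (proj₁ B y) (λ x → e (x , y)))
        (if-measurable (Sub X ⊗ Y)
          (meas⇒measurable (Sub X ⊗ Y) (meas-proj₂ (Sub X) Y (measurable⇒meas Y (proj₂ B)))) (μ-measurable A))
      where
      section : ∀ y → Measurable X (λ x → C (x , y))
      section = sectionʳ X Y (gen (A , B , e))
      value : ∀ ν (E : Event X) b → (∀ x → proj₁ E x ≡ proj₁ A x ∧ b) → (if b then μ ν A else 0#) ≈ μ ν E
      value ν E true  eq = SubProb.μ-cong ν A E (λ x → sym (trans (eq x) (∧-identityʳ _)))
      value ν E false eq = Eq.trans (Eq.sym (SubProb.μ-empty ν))
        (SubProb.μ-cong ν (∅ , ∅-measurable X) E (λ x → sym (trans (eq x) (∧-zeroʳ _))))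

    -- Induction over the Dynkin class rather than the σ-algebra: complements become differences
    -- from the total mass, and disjoint unions become suprema of partial sums, whereas general
    -- unions have no formula for their measure.
    measurable-sections : ∀ {K} → Measurable (X ⊗ Y) K → MeasurableSections K
    measurable-sections = go ∘ PiLambda.generated⇒dynkin ∩-closed
      where
      Rectangle : Pred (Pow (Point X × Point Y)) (ℓ ⊔ ℓ′)
      Rectangle C = Σ[ A ∈ Event X ] Σ[ B ∈ Event Y ] C ≐ (λ (x , y) → proj₁ A x ∧ proj₁ B y)
      interchange : ∀ a b c d → (a ∧ b) ∧ (c ∧ d) ≡ (a ∧ c) ∧ (b ∧ d)
      interchange true  b true  d = refl
      interchange true  b false d = ∧-zeroʳ b
      interchange false b c     d = refl
      ∩-closed : ∀ {C D} → Rectangle C → Rectangle D → Dynkin Rectangle (C ∩ D)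
      ∩-closed (A , B , e) (A′ , B′ , e′) = gen (intersect X A A′ , intersect Y B B′ , λ (x , y) →
        trans (cong₂ _∧_ (e (x , y)) (e′ (x , y))) (interchange (proj₁ A x) (proj₁ B y) _ _))
      go : ∀ {K} → Dynkin Rectangle K → MeasurableSections K
      go (gen (A , B , e)) = rectangle-sections A B e
      go (resp e d) = let m , mf = go d in
        (λ y → ≐-measurable X (λ x → e (x , y)) (m y)) ,
        <-measurable-resp (Sub X ⊗ Y) (λ (ν , y) → SubProb.μ-cong ν _ _ (λ x → e (x , y))) mf
      go empty = (λ y → ∅-measurable X) ,
        <-measurable-resp (Sub X ⊗ Y) (λ (ν , y) → Eq.sym (SubProb.μ-empty ν)) (const-measurable (Sub X ⊗ Y) 0#)
      go (compl {K} d) = let m , mf = go d in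
        (λ y → ∁-measurable X (m y)) ,
        ∸-measurable (Sub X ⊗ Y) mf (μ-measurable (fullᴱ X))
          (λ (ν , y) → μ-union ν _ _ (fullᴱ X) (λ x t s → not-T s t) (λ x → ∨-inverseʳ (K (x , y))))
      go (disjUni {K} dis d) =
        (λ y → ⋃-measurable X (λ n → proj₁ (go (d n)) y)) ,
        sup-measurable (Sub X ⊗ Y) (λ n → ∑-measurable (Sub X ⊗ Y) n (λ i → proj₂ (go (d i))))
          (λ (ν , y) → SubProb.μ-additive ν (λ n → _ , proj₁ (go (d n)) y) (λ m n m≢n x → dis m n m≢n (x , y)))

  -- Integration

  -- `complete` speaks of predicates of level zero; passing to truth values brings `P` down to that
  -- level.
  sup-exists : (P : Pred ℝ p) → ∃ P → ∃ (IsUpperBound P) → ∃ (IsSup P)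
  sup-exists P (x , Px) (u , ub) =
    let s , s-ub , s-least = complete (λ y → T (does (em {P = P y}))) (x , T-em Px) (u , λ t → ub (em-T t))
    in s , (λ Py → s-ub (T-em Py)) , λ v v-ub → s-least v (λ t → v-ub (em-T t))

  sum-neg : ∀ n (x : Vector ℝ n) → sum (λ i → - x i) ≈ - sum x
  sum-neg zero    x = Eq.sym ε⁻¹≈ε
  sum-neg (suc n) x = Eq.trans (+-congˡ (sum-neg n (x ∘ Fin.suc))) (⁻¹-∙-comm _ _)

  ⟦_⟧ : Set p → ℝ
  ⟦ P ⟧ = if does (em {P = P}) then 1# else 0#

  ⟦⟧-true : {P : Set p} → P → ⟦ P ⟧ ≈ 1#
  ⟦⟧-true {P = P} h with em {P = P}
  ... | yes _ = Eq.refl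
  ... | no ¬h = ⊥-elim (¬h h)

  ⟦⟧-false : {P : Set p} → ¬ P → ⟦ P ⟧ ≈ 0#
  ⟦⟧-false {P = P} ¬h with em {P = P}
  ... | yes h = ⊥-elim (¬h h)
  ... | no _  = Eq.refl

  ⟦⟧-nonneg : (P : Set p) → 0# ≤ ⟦ P ⟧
  ⟦⟧-nonneg P with em {P = P}
  ... | yes _ = 0≤1
  ... | no _  = ≤.refl

  -- Approximation of a number by a staircase.

  module Staircase (c : ℝ) (0≤c : 0# ≤ c) where
    open ≤-Reasoning

    Steps : (ℕ → ℝ) → Set
    Steps θ = ∀ k → θ (suc k) ≈ θ k + c

    -- The thresholds are a parameter so that inductions can pass to `θ ∘ suc`. Counting starts at
    -- `θ 1` because `θ 0` is the ground from which heights are measured.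
    stairs : (ℕ → ℝ) → ℕ → ℝ → ℝ
    stairs θ n y = ∑ n (λ k → c * ⟦ θ (suc k) < y ⟧)

    stairs-nonneg : ∀ θ n y → 0# ≤ stairs θ n y
    stairs-nonneg θ zero    y = ≤.refl
    stairs-nonneg θ (suc n) y = +-nonneg (*-nonneg 0≤c (⟦⟧-nonneg (θ 1 < y))) (stairs-nonneg (θ ∘ suc) n y)

    stairs-above : ∀ θ → Steps θ → ∀ n y → y ≤ θ 1 → stairs θ n y ≈ 0#
    stairs-above θ step zero    y y≤θ₁ = Eq.refl
    stairs-above θ step (suc n) y y≤θ₁ = Eq.trans (+-cong
      (Eq.trans (*-congˡ (⟦⟧-false (λ θ₁<y → <⇒≱ θ₁<y y≤θ₁))) (zeroʳ c))
      (stairs-above (θ ∘ suc) (step ∘ suc) n y (≤.trans y≤θ₁ (≤-resp Eq.refl (Eq.sym (step 1)) (x≤x+y 0≤c)))))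
      (+-identityˡ 0#)

    stairs-step : ∀ θ → Steps θ → ∀ n y → θ 1 < y → θ 0 + stairs θ (suc n) y ≈ θ 1 + stairs (θ ∘ suc) n y
    stairs-step θ step n y θ₁<y = Eq.trans (Eq.sym (+-assoc _ _ _)) (+-congʳ (Eq.trans
      (+-congˡ (Eq.trans (*-congˡ (⟦⟧-true θ₁<y)) (*-identityʳ c))) (Eq.sym (step 0))))

    -- Above `θ 1` the first step is absorbed into the ground level and the staircase shifts;
    -- otherwise no step is taken at all.
    stairs-lower : ∀ θ → Steps θ → ∀ n y → θ 0 ≤ y → θ 0 + stairs θ n y ≤ y
    stairs-lower θ step zero    y θ₀≤y = ≤-resp (Eq.sym (+-identityʳ _)) Eq.refl θ₀≤y
    stairs-lower θ step (suc n) y θ₀≤y with <∨≥ (θ 1) y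
    ... | inj₁ θ₁<y = ≤-resp (Eq.sym (stairs-step θ step n y θ₁<y)) Eq.refl
                       (stairs-lower (θ ∘ suc) (step ∘ suc) n y (proj₁ θ₁<y))
    ... | inj₂ y≤θ₁ = ≤-resp (Eq.sym (Eq.trans (+-congˡ (stairs-above θ step (suc n) y y≤θ₁)) (+-identityʳ _))) Eq.refl θ₀≤y

    -- `y ≤ θ n` keeps `y` within reach of the `n` steps. The error `c` arises where the climb
    -- stops, with `y` at most one step above the ground.
    stairs-upper : ∀ θ → Steps θ → ∀ n y → y ≤ θ n → y ≤ θ 0 + stairs θ n y + c
    stairs-upper θ step zero    y y≤θₙ = ≤.trans y≤θₙ (≤.trans (≤.reflexive (Eq.sym (+-identityʳ _))) (x≤x+y 0≤c))
    stairs-upper θ step (suc n) y y≤θₙ with <∨≥ (θ 1) y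
    ... | inj₁ θ₁<y = ≤-resp Eq.refl (+-congʳ (Eq.sym (stairs-step θ step n y θ₁<y)))
                       (stairs-upper (θ ∘ suc) (step ∘ suc) n y y≤θₙ)
    ... | inj₂ y≤θ₁ = begin
      y                             ≤⟨ y≤θ₁ ⟩
      θ 1                           ≈⟨ step 0 ⟩
      θ 0 + c                       ≤⟨ +-monoˡ-≤ c (x≤x+y (stairs-nonneg θ (suc n) y)) ⟩
      θ 0 + stairs θ (suc n) y + c  ∎

  -- Monotonicity of the integral of simple functions.

  module _ {X : MeasurableSpace ℓ} (ν : SubProb X) where

    private
      module ν = SubProb ν

    inside outside : Event X → Event X → Event X
    inside      = intersect X
    outside A B = intersect X A (∁ᴱ {X = X} B)

    Additive : (Event X → ℝ) → Set ℓ
    Additive H = ∀ F E → H (inside F E) + H (outside F E) ≈ H F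

    split-by : ∀ a e → a ≡ (a ∧ e) ∨ (a ∧ not e)
    split-by true  true  = refl
    split-by true  false = refl
    split-by false e     = refl

    additive-μ : ∀ E → Additive (λ F → ν.μ (inside F E))
    additive-μ E F G = μ-union ν _ _ _
      (λ x s t → not-T (proj₂ (Equivalence.to (T-∧ {proj₁ F x}) (proj₁ (Equivalence.to T-∧ t))))
                       (proj₂ (Equivalence.to (T-∧ {proj₁ F x}) (proj₁ (Equivalence.to T-∧ s)))))
      (λ x → lemma (proj₁ F x) (proj₁ G x) (proj₁ E x))
      where
      lemma : ∀ f g e → ((f ∧ g) ∧ e) ∨ ((f ∧ not g) ∧ e) ≡ f ∧ e
      lemma true  true  true  = refl
      lemma true  true  false = refl
      lemma true  false e     = refl
      lemma false g     e     = refl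

    μ-split : ∀ F E → ν.μ (inside F E) + ν.μ (outside F E) ≈ ν.μ F
    μ-split F E = μ-union ν _ _ _
      (λ x s t → not-T (proj₂ (Equivalence.to (T-∧ {proj₁ F x}) t)) (proj₂ (Equivalence.to (T-∧ {proj₁ F x}) s)))
      (λ x → sym (split-by (proj₁ F x) (proj₁ E x)))

    -- H F stands for the integral of h over F.  The constant e makes the property
    -- inductive: adding c 1_E to h adds c to the constant on E.
    record Positive (h : Point X → ℝ) (H : Event X → ℝ) : Set ℓ where
      field
        additive : Additive H
        positive : ∀ e F → (∀ t → t ∈ proj₁ F → 0# ≤ e + h t) → 0# ≤ e * ν.μ F + H F
    open Positive

    positive-zero : Positive (λ _ → 0#) (λ _ → 0#)
    additive positive-zero F E = +-identityˡ 0#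
    -- A point of `F` yields `0 ≤ e`. Without one the hypothesis tells nothing about `e`, but then
    -- `F` has measure zero.
    positive positive-zero e F h with em {P = ∃[ t ] t ∈ proj₁ F}
    ... | yes (t , t∈F) = +-nonneg (*-nonneg (≤-resp Eq.refl (+-identityʳ e) (h t t∈F)) (ν.μ-nonneg F)) ≤.refl
    ... | no F-empty    = +-nonneg (≤.reflexive (Eq.sym (Eq.trans (*-congˡ μF≈0) (zeroʳ e)))) ≤.refl
      where
      μF≈0 : ν.μ F ≈ 0#
      μF≈0 = Eq.trans (ν.μ-cong F (∅ , ∅-measurable X) (λ x → bool-ext (λ t → F-empty (x , t)) (λ ()))) ν.μ-empty

    open SemiringSolver commutativeSemiring using (solve; _:=_; _:+_; _:*_)

    -- `F` is cut along `E`, and `P` is used with constant `e + c` inside and `e` outside. The sign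
    -- of `c` is free, which lets `simple-mono` treat differences.
    positive-step : ∀ {h H} c E → Positive h H →
      Positive (λ t → c * indicator (proj₁ E) t + h t) (λ F → c * ν.μ (inside F E) + H F)
    additive (positive-step c E P) F G = Eq.trans
      (solve 5 (λ c a b h k → (c :* a :+ h) :+ (c :* b :+ k) := c :* (a :+ b) :+ (h :+ k)) Eq.refl c _ _ _ _)
      (+-cong (*-congˡ (additive-μ E F G)) (additive P F G))
    positive (positive-step {h} {H} c E P) e F pos = ≤-resp (+-identityˡ 0#)
      (Eq.trans
        (solve 6 (λ e c a b h k → ((e :+ c) :* a :+ h) :+ (e :* b :+ k) := e :* (a :+ b) :+ (c :* a :+ (h :+ k)))
          Eq.refl e c _ _ _ _)
        (+-cong (*-congˡ (μ-split F E)) (+-congˡ (additive P F E))))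
      (+-mono-≤
        (positive P (e + c) (inside F E) λ t t∈ → let f , i = Equivalence.to T-∧ t∈ in
          ≤-resp Eq.refl (on (proj₁ E t) i) (pos t f))
        (positive P e (outside F E) λ t t∈ → let f , o = Equivalence.to (T-∧ {proj₁ F t}) t∈ in
          ≤-resp Eq.refl (off (proj₁ E t) (not-T o)) (pos t f)))
      where
      on : ∀ b {h} → T b → e + (c * (if b then 1# else 0#) + h) ≈ (e + c) + h
      on true _ = Eq.trans (+-congˡ (+-congʳ (*-identityʳ c))) (Eq.sym (+-assoc e c _))
      off : ∀ b {h} → ¬ T b → e + (c * (if b then 1# else 0#) + h) ≈ e + h
      off true  ¬b = ⊥-elim (¬b _)
      off false ¬b = +-congˡ (Eq.trans (+-congʳ (zeroʳ c)) (+-identityˡ _))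

    positive-resp : ∀ {h k H K} → (∀ t → h t ≈ k t) → (∀ F → H F ≈ K F) → Positive h H → Positive k K
    additive (positive-resp e E P) F G = Eq.trans (+-cong (Eq.sym (E _)) (Eq.sym (E _))) (Eq.trans (additive P F G) (E F))
    positive (positive-resp e E P) r F pos = ≤-resp Eq.refl (+-congˡ (E F))
      (positive P r F (λ t t∈F → ≤-resp Eq.refl (+-congˡ (Eq.sym (e t))) (pos t t∈F)))

    positive-sum : ∀ {h H} n (c : Vector ℝ n) (E : Vector (Event X) n) → Positive h H →
      Positive (λ t → sum (λ i → c i * indicator (proj₁ (E i)) t) + h t)
               (λ F → sum (λ i → c i * ν.μ (inside F (E i))) + H F)
    positive-sum zero    c E P = positive-resp (λ t → Eq.sym (+-identityˡ _)) (λ F → Eq.sym (+-identityˡ _)) P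
    positive-sum (suc n) c E P = positive-resp (λ t → Eq.sym (+-assoc _ _ _)) (λ F → Eq.sym (+-assoc _ _ _))
      (positive-step (c Fin.zero) (E Fin.zero) (positive-sum n (c ∘ Fin.suc) (E ∘ Fin.suc) P))

    -- The difference of the two simple functions is again a combination of indicators, so its
    -- positivity up to `e` passes to the integrals by `positive-sum`, without a common refinement.
    -- The error stays below `e` because the total mass is at most 1.
    simple-mono : ∀ {m n} e (c : Vector ℝ m) (E : Vector (Event X) m) (d : Vector ℝ n) (D : Vector (Event X) n) → 0# ≤ e →
      (∀ t → sum (λ i → c i * indicator (proj₁ (E i)) t) ≤ sum (λ i → d i * indicator (proj₁ (D i)) t) + e) →
      sum (λ i → c i * ν.μ (E i)) ≤ sum (λ i → d i * ν.μ (D i)) + e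
    simple-mono {m} {n} e c E d D 0≤e h = begin
      sum (λ i → c i * ν.μ (E i))                  ≈⟨ total m c E ⟩
      C full                                       ≤⟨ +-cancel (positive P e full (λ t _ → move (h t))) ⟩
      e * ν.μ full + D′ full                       ≤⟨ +-monoˡ-≤ _ (≤-resp (*-comm _ e) (*-identityˡ e) (*-monoʳ-≤ e 0≤e (ν.μ-subprob full))) ⟩
      e + D′ full                                  ≈⟨ +-comm e _ ⟩
      D′ full + e                                  ≈⟨ +-congʳ (total n d D) ⟨
      sum (λ i → d i * ν.μ (D i)) + e              ∎
      where
      open ≤-Reasoning
      full : Event X
      full = fullᴱ X
      total : ∀ n (c : Vector ℝ n) (E : Vector (Event X) n) →
        sum (λ i → c i * ν.μ (E i)) ≈ sum (λ i → c i * ν.μ (inside full (E i)))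
      total n c E = sum-cong-≋ {n} (λ i → *-congˡ (ν.μ-cong (E i) (inside full (E i)) (λ x → refl)))
      C D′ : Event X → ℝ
      C F  = sum (λ i → c i * ν.μ (inside F (E i)))
      D′ F = sum (λ i → d i * ν.μ (inside F (D i)))
      negate : ∀ {k} (c x : Vector ℝ k) → sum (λ i → - c i * x i) ≈ - sum (λ i → c i * x i)
      negate {k} c x = Eq.trans (sum-cong-≋ {k} (λ i → Eq.sym (-‿distribˡ-* (c i) (x i)))) (sum-neg k (λ i → c i * x i))
      P : Positive (λ t → - sum (λ i → c i * indicator (proj₁ (E i)) t) + (sum (λ i → d i * indicator (proj₁ (D i)) t) + 0#))
                   (λ F → - C F + (D′ F + 0#))
      P = positive-resp (λ t → +-congʳ (negate c (λ i → indicator (proj₁ (E i)) t)))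
                        (λ F → +-congʳ (negate c (λ i → ν.μ (inside F (E i)))))
            (positive-sum m (λ i → - c i) E (positive-sum n d D positive-zero))
      rearrange : ∀ e x y → (e + (- x + (y + 0#))) + x ≈ e + y
      rearrange e x y = Eq.trans
        (+-congʳ (Eq.trans (+-congˡ (Eq.trans (+-congˡ (+-identityʳ y)) (+-comm (- x) y))) (Eq.sym (+-assoc e y (- x)))))
        (//-rightDividesˡ x (e + y))
      +-cancel : ∀ {e x y} → 0# ≤ e + (- x + (y + 0#)) → x ≤ e + y
      +-cancel {e} {x} {y} p = ≤-resp (+-identityˡ x) (rearrange e x y) (+-monoˡ-≤ x p)
      move : ∀ {x y} → x ≤ y + e → 0# ≤ e + (- x + (y + 0#))
      move {x} {y} p = +-cancelʳ-≤ x (≤-resp (Eq.sym (+-identityˡ x)) (Eq.trans (+-comm y e) (Eq.sym (rearrange e x y))) p)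

  -- Layer sums approximating an integral.

  module Layers {X : MeasurableSpace ℓ} (ν : SubProb X) {g : Point X → ℝ}
    (g-measurable : MeasurableFn X g) (0≤g : ∀ t → 0# ≤ g t) (g≤1 : ∀ t → g t ≤ 1#) where

    mesh : ℕ → ℝ
    mesh N = ι (suc N) ⁻¹

    mesh-nonneg : ∀ N → 0# ≤ mesh N
    mesh-nonneg N = proj₁ (⁻¹-pos (ι-pos N))

    level : ℕ → ℕ → ℝ
    level N k = ι k * mesh N

    level-step : ∀ N → Staircase.Steps (mesh N) (mesh-nonneg N) (level N)
    level-step N k = Eq.trans (distribʳ (mesh N) 1# (ι k)) (Eq.trans (+-congʳ (*-identityˡ _)) (+-comm _ _))

    superlevel : ℕ → ℕ → Event X
    superlevel N k = comprehend (λ t → level N (suc k) < g t) , g-measurable (level N (suc k))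

    -- A lower Riemann sum for the layer-cake formula, which writes the integral of `g` as the
    -- integral over `r` of the measure of `g > r`.
    layerSum : ℕ → ℝ
    layerSum N = ∑ (suc N) (λ k → mesh N * μ ν (superlevel N k))

    layers-lower : ∀ N t → ∑ (suc N) (λ k → mesh N * indicator (proj₁ (superlevel N k)) t) ≤ g t
    layers-lower N t = ≤-resp (Eq.trans (+-congʳ (zeroˡ (mesh N))) (+-identityˡ _)) Eq.refl
      (Staircase.stairs-lower (mesh N) (mesh-nonneg N) (level N) (level-step N) (suc N) (g t)
        (≤-resp (Eq.sym (zeroˡ (mesh N))) Eq.refl (0≤g t)))

    layers-upper : ∀ N t → g t ≤ ∑ (suc N) (λ k → mesh N * indicator (proj₁ (superlevel N k)) t) + mesh N
    layers-upper N t = ≤-resp Eq.refl (+-congʳ (Eq.trans (+-congʳ (zeroˡ (mesh N))) (+-identityˡ _)))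
      (Staircase.stairs-upper (mesh N) (mesh-nonneg N) (level N) (level-step N) (suc N) (g t)
        -- The top level `ι (suc N) * mesh N` is 1, so the staircase reaches every value of `g`.
        (≤-resp Eq.refl (Eq.sym (*-inverseʳ (ι≉0 N))) (g≤1 t)))

    layerSum-below : ∀ N → SimpleIntegralBelow X ν g (layerSum N)
    layerSum-below N = suc N , (λ _ → mesh N) , (λ i → superlevel N (toℕ i)) ,
      (λ _ → mesh-nonneg N) , layers-lower N , Eq.refl

    -- Any simple function below `g` exceeds the staircase by at most one mesh. The bound is uniform
    -- in the simple function, so it also shows that the integral is finite.
    below-layerSum : ∀ {x} → SimpleIntegralBelow X ν g x → ∀ N → x ≤ layerSum N + mesh N
    below-layerSum (k , c , E , 0≤c , le , e) N = ≤-resp (Eq.sym e) Eq.refl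
      (simple-mono ν (mesh N) c E (λ (_ : Fin (suc N)) → mesh N) (λ i → superlevel N (toℕ i)) (mesh-nonneg N)
        (λ t → ≤.trans (le t) (layers-upper N t)))

    integral-exists : ∃ (IsIntegral X ν g)
    integral-exists = let x , sup = sup-exists (SimpleIntegralBelow X ν g) (_ , layerSum-below 0)
                                      (layerSum 0 + mesh 0 , λ b → below-layerSum b 0)
                      in x , g-measurable , sup

    layerSum<integral : ∀ {x r} → IsIntegral X ν g x → ∀ N → r < layerSum N → r < x
    layerSum<integral (_ , ub , _) N h = <-≤-trans h (ub (layerSum-below N))

    -- Some simple integral `y` already exceeds `r`; a mesh finer than `y - r` leaves room for the
    -- error of `below-layerSum`.
    integral>⇒layerSum> : ∀ {x r} → IsIntegral X ν g x → r < x → ∃[ N ] r < layerSum N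
    integral>⇒layerSum> {x} {r} (_ , _ , least) r<x with em {P = ∃[ y ] SimpleIntegralBelow X ν g y × r < y}
    ... | no none = ⊥-elim (<⇒≱ r<x (least r (λ {y} b → ≮⇒≥ (λ r<y → none (y , b , r<y)))))
    ... | yes (y , b , r<y) = let N , small = ∃-small (0<y-x r<y) in
      N , +-cancelʳ-< (mesh N) (<-≤-trans (<-resp (+-comm (mesh N) r) Eq.refl (x<z-y⇒x+y<z small)) (below-layerSum b N))

  -- The Souslin operation

  extend : List ℕ → ℕ → ℕ
  extend []      i       = 0
  extend (x ∷ v) zero    = x
  extend (x ∷ v) (suc i) = extend v i

  extend-applyUpTo : ∀ α n i → i ℕ.< n → extend (applyUpTo α n) i ≡ α i
  extend-applyUpTo α (suc n) zero    i<n       = refl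
  extend-applyUpTo α (suc n) (suc i) (ℕ.s≤s i<n) = extend-applyUpTo (α ∘ suc) n i i<n

  -- A condition reading finitely many letters can be evaluated at any extension of the word read,
  -- here the one padded with zeros. This turns `M` into a family indexed by words.
  souslin-local : ∀ {ℓ p} (X : MeasurableSpace ℓ) → SouslinClosed X → (M : (ℕ → ℕ) → ℕ → Pred (Point X) p) →
    (∀ {α β} n {x} → (∀ i → i ℕ.≤ n → α i ≡ β i) → M α n x → M β n x) →
    (∀ α n → Meas X (M α n)) → Meas X (λ x → Σ[ α ∈ (ℕ → ℕ) ] ∀ n → M α n x)
  souslin-local X closed M local m = meas-resp X
    {P = λ x → Σ[ α ∈ (ℕ → ℕ) ] ∀ n → x ∈ A (applyUpTo α n)} {Q = λ x → Σ[ α ∈ (ℕ → ℕ) ] ∀ n → M α n x}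
    (λ x (α , h) → α , λ n → local n (λ i i≤n → extend-applyUpTo α (suc n) i (ℕ.s≤s i≤n))
      (subst (λ k → M (extend (applyUpTo α (suc n))) k x) (length-applyUpTo (α ∘ suc) n) (em-T (h (suc n)))))
    (λ x (α , h) → α , λ { zero → _ ; (suc n) → T-em
      (subst (λ k → M (extend (applyUpTo α (suc n))) k x) (sym (length-applyUpTo (α ∘ suc) n))
        (local n (λ i i≤n → sym (extend-applyUpTo α (suc n) i (ℕ.s≤s i≤n))) (h n))) })
    (closed A λ { [] → ∁-measurable X (∅-measurable X) ; (k ∷ v) → m (extend (k ∷ v)) (length v) })
    where
    A : List ℕ → Pow (Point X)
    -- `M α n` reads the letters up to index `n`, so it sits at words of length `n + 1`; the empty
    -- word carries the whole space.
    A []      = ∁ ∅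
    A (k ∷ v) = comprehend (M (extend (k ∷ v)) (length v))

-- Joint measurability of the interpretation.

module Interpretations
  (em : {a : Level} → ExcludedMiddle a) (R : CompleteOrderedField)
  (Λ : Theory.SubProb em R (Theory.unitInterval em R))
  {g ℓ : Level} {Γ : Set g} {ε : Γ} (𝒢 : Theory.GameFrame em R Γ ε ℓ) where

  open CompleteOrderedField R
  open Theory em R
  open Analysis em R
  open GameFrame 𝒢
  open Interpretation Λ 𝒢
  open import Algebra.Properties.Monoid.Sum +-monoid using (sum-cong-≗)

  I : MeasurableSpace 0ℓ
  I = unitInterval

  S×I SubS×I : MeasurableSpace ℓ
  S×I    = S ⊗ I
  SubS×I = Sub S ⊗ I

  JointlyMeasurable : Value → Set ℓ
  JointlyMeasurable f = ∀ A → Measurable S×I (λ (s , q) → f A (proj₁ q) s)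

  joint-section : ∀ {f} → JointlyMeasurable f → ∀ A q → 0# ≤ q → q ≤ 1# → Measurable S (f A q)
  joint-section J A q 0≤q q≤1 = sectionʳ S I (J A) (q , 0≤q , q≤1)

  joint-atomic : ∀ γ → JointlyMeasurable (atomic γ)
  joint-atomic γ A = StochasticEffectivity.tmeasurable (P γ) (comprehend (λ (ν , q) → proj₁ q < μ ν A))
    (hypograph-measurable (Sub S) {f = λ ν → μ ν A} (λ c → gen (A , c , λ _ → refl)))

  joint-dual : ∀ {f} → JointlyMeasurable f → JointlyMeasurable (dual f)
  joint-dual J A = compl (J (∁ᴱ {X = S} A))

  fromℚ-nonneg : ∀ p → 0ℚ ℚ.≤ p → 0# ≤ fromℚ p
  fromℚ-nonneg p 0≤p with num p 0≤p
  ... | n , e rewrite e = *-nonneg (ι-nonneg n) (proj₁ (⁻¹-pos (ι-pos (ℚ.denominator-1 p))))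

  -- For a fixed pair of rationals the budget enters only through `q < a + b`. Replacing `q` by 1 in
  -- the remaining constraint separates `q` from `s` and keeps both parameters in the unit interval,
  -- where `f` and `h` have measurable sections.
  joint-choice : ∀ {f h} → JointlyMeasurable f → JointlyMeasurable h → JointlyMeasurable (choice f h)
  joint-choice {f} {h} Jf Jh A = meas-∀-enumerated S×I enumℚ² enumℚ²-surjective
    {P = λ a (s , q) → Q² (proj₁ q) a → s ∈ f A (fromℚ (proj₁ a)) ∪ h A (fromℚ (proj₂ a))} λ (a , b) →
    meas-resp S×I
      {P = λ (s , q) → proj₁ q < fromℚ a + fromℚ b ⊎ (Q² 1# (a , b) → s ∈ f A (fromℚ a) ∪ h A (fromℚ b))}
      {Q = λ (s , q) → Q² (proj₁ q) (a , b) → s ∈ f A (fromℚ a) ∪ h A (fromℚ b)}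
      (λ { (s , q) (inj₁ q<) (_ , _ , ≤q) → ⊥-elim (<⇒≱ q< ≤q)
         ; (s , q , 0≤q , q≤1) (inj₂ t) (0≤a , 0≤b , ≤q) → t (0≤a , 0≤b , ≤.trans ≤q q≤1) })
      (λ (s , q) t → [ inj₁ , (λ ≤q → inj₂ (λ (0≤a , 0≤b , _) → t (0≤a , 0≤b , ≤q))) ]′ (<∨≥ (proj₁ q) (fromℚ a + fromℚ b)))
      (meas-⊎ S×I
        (meas-proj₂ S I (below-measurable (fromℚ a + fromℚ b)))
        (meas-→ S×I λ (0≤a , 0≤b , a+b≤1) → let 0≤a′ = fromℚ-nonneg a 0≤a ; 0≤b′ = fromℚ-nonneg b 0≤b in
          meas-proj₁ S I (meas-resp S {P = λ s → s ∈ f A (fromℚ a) ⊎ s ∈ h A (fromℚ b)}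
            {Q = λ s → s ∈ f A (fromℚ a) ∪ h A (fromℚ b)}
            (λ s → Equivalence.from T-∨) (λ s → Equivalence.to T-∨)
            (meas-⊎ S
              (measurable⇒meas S (joint-section {f} Jf A (fromℚ a) 0≤a′ (≤.trans (x≤x+y 0≤b′) a+b≤1)))
              (measurable⇒meas S (joint-section {h} Jh A (fromℚ b) 0≤b′
                (≤.trans (≤-resp Eq.refl (+-comm _ _) (x≤x+y 0≤a′)) a+b≤1)))))))

  joint-after : ∀ γ {f} → JointlyMeasurable f → JointlyMeasurable (after γ f)
  joint-after γ {f} J A = StochasticEffectivity.tmeasurable (P γ) (comprehend InG) InG-measurable
    where
    sections : MeasurableSections S I (λ (s , q) → f A (proj₁ q) s)
    sections = measurable-sections S I (J A)
    w : SubProb S → Interval → ℝ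
    w ν r = μ ν (f A (proj₁ r) , proj₁ sections r)
    w-measurable : ∀ ν → MeasurableFn I (w ν)
    w-measurable ν c = sectionˡ (Sub S) I (proj₂ sections c) ν
    open module L (ν : SubProb S) = Layers {X = I} Λ {w ν} (w-measurable ν)
      (λ r → SubProb.μ-nonneg ν (f A (proj₁ r) , proj₁ sections r))
      (λ r → SubProb.μ-subprob ν (f A (proj₁ r) , proj₁ sections r))
    layerSum-measurable : ∀ N → MeasurableFn (Sub S) (λ ν → layerSum ν N)
    layerSum-measurable N = ∑-measurable (Sub S) (suc N) {λ k ν → ι (suc N) ⁻¹ * μ Λ (superlevel ν N k)} λ k →
      let c = ι (suc k) * ι (suc N) ⁻¹
          -- Here the roles change: the measure varies over `Sub I` and `ν` is the parameter. The
          -- section at `Λ` leaves a measurable function of `ν`.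
          m′ , mf = measurable-sections I (Sub S)
            (swap-measurable (Sub S) I {K = comprehend (λ (ν , r) → c < w ν r)} (proj₂ sections c))
      in <-measurable-resp (Sub S)
           {f = λ ν → μ Λ (comprehend (λ r → c < w ν r) , m′ ν) * ι (suc N) ⁻¹}
           {g = λ ν → ι (suc N) ⁻¹ * μ Λ (superlevel ν N k)}
           (λ ν → Eq.trans (*-congʳ (SubProb.μ-cong Λ _ (superlevel ν N k) (λ _ → refl))) (*-comm _ _))
           (*-measurable (Sub S) (⁻¹-pos (ι-pos N)) (λ d → sectionˡ (Sub I) (Sub S) (mf d) Λ))
    InG : Pred (SubProb S × Interval) ℓ
    InG (ν , q) = Σ[ m ∈ ((r : Interval) → Measurable S (f A (proj₁ r))) ] ∃[ x ]
      IsIntegral unitInterval Λ (λ r → μ ν (f A (proj₁ r) , m r)) x × proj₁ q < x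
    InG-measurable : Meas SubS×I InG
    InG-measurable = meas-resp SubS×I {P = λ (ν , q) → ∃[ N ] proj₁ q < layerSum ν N} {Q = InG}
      (λ (ν , q) (N , q<) → let x , int = integral-exists ν in
        proj₁ sections , x , int , layerSum<integral ν int N q<)
      -- The measurability proofs `m` may differ from those in `sections`; `μ-cong` makes the
      -- integrands agree.
      (λ (ν , q) (m , x , int , q<x) → integral>⇒layerSum> ν
        (IsIntegral-cong (λ r → SubProb.μ-cong ν (f A (proj₁ r) , m r) (f A (proj₁ r) , proj₁ sections r) (λ _ → refl)) int) q<x)
      (meas-∃ SubS×I λ N → hypograph-measurable (Sub S) (layerSum-measurable N))

  term≤∑ : ∀ n a → (∀ i → 0# ≤ a i) → a n ≤ ∑ (suc n) a
  term≤∑ zero    a 0≤a = ≤.reflexive (Eq.sym (+-identityʳ _))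
  term≤∑ (suc n) a 0≤a = ≤.trans (term≤∑ n (a ∘ suc) (0≤a ∘ suc)) (≤-resp Eq.refl (+-comm _ _) (x≤x+y (0≤a 0)))

  joint-iterate : ∀ {F} → (∀ {f} → JointlyMeasurable f → JointlyMeasurable (F f)) →
    ∀ n {f} → JointlyMeasurable f → JointlyMeasurable (iterate F n f)
  joint-iterate JF zero    J = J
  joint-iterate JF (suc n) J = JF (joint-iterate JF n J)

  -- Iteration: losing sequences and their threshold.

  module _ (closed : SouslinClosed S) where

    module Angelic (f : ℕ → Value) (J : ∀ n → JointlyMeasurable (f n)) (A : Event S) where

      -- α codes the sequence of rationals, and B constrains its partial sums.  Terms
      -- above 1 are excluded because f n is only known to be measurable on [0,1].
      Losing : (ℝ → Pred (Point S) 0ℓ) → (ℕ → ℕ) → ℕ → Pred (Point S) 0ℓ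
      Losing B α n s =
        (0ℚ ℚ.≤ enumℚ (α n) × fromℚ (enumℚ (α n)) ≤ 1#) ×
        B (∑ n (fromℚ ∘ enumℚ ∘ α)) s ×
        ¬ (s ∈ f n A (fromℚ (enumℚ (α n))))

      Loses : (ℝ → Pred (Point S) 0ℓ) → Pred (Point S) 0ℓ
      Loses B s = Σ[ α ∈ (ℕ → ℕ) ] ∀ n → Losing B α n s

      -- The union runs over uncountably many `α`, which calls for the Souslin operation. Stage `n`
      -- reads only the letters up to `α n`, as `souslin-local` requires.
      loses-measurable : (B : ℝ → Pred (Point S) 0ℓ) → (∀ x → Meas S (B x)) → Meas S (Loses B)
      loses-measurable B mB = souslin-local S closed (Losing B) local λ α n →
        meas-guard S {Z = 0ℚ ℚ.≤ enumℚ (α n) × fromℚ (enumℚ (α n)) ≤ 1#} λ (0≤a , a≤1) →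
        meas-× S (mB (∑ n (fromℚ ∘ enumℚ ∘ α))) (meas-¬ S (measurable⇒meas S
          (joint-section {f n} (J n) A _ (fromℚ-nonneg _ 0≤a) a≤1)))
        where
        local : ∀ {α β} n {s} → (∀ i → i ℕ.≤ n → α i ≡ β i) → Losing B α n s → Losing B β n s
        local {α} {β} n {s} e (bounds , b , lost) =
          subst (λ k → 0ℚ ℚ.≤ enumℚ k × fromℚ (enumℚ k) ≤ 1#) (e n ℕ.≤-refl) bounds ,
          subst (λ x → B x s) (sum-cong-≗ {n} (λ i → cong (fromℚ ∘ enumℚ) (e (toℕ i) (ℕ.<⇒≤ (toℕ<n i))))) b ,
          subst (λ k → ¬ (s ∈ f n A (fromℚ (enumℚ k)))) (e n ℕ.≤-refl) lost

      loses-mono : ∀ {B B′ : ℝ → Pred (Point S) 0ℓ} {s} →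
        (∀ x → B x s → B′ x s) → Loses B s → Loses B′ s
      loses-mono h (α , l) = α , λ n → let bounds , b , lost = l n in bounds , h _ b , lost

      AtMost : ℝ → ℝ → Pred (Point S) 0ℓ
      AtMost q x _ = x ≤ q

      LosesAt : ℝ → Pred (Point S) 0ℓ
      LosesAt q = Loses (AtMost q)

      losesAt-measurable : ∀ q → Meas S (LosesAt q)
      losesAt-measurable q = loses-measurable (AtMost q) (λ x → meas-const S (x ≤ q))

      -- The bound by the infimum of the losing budgets, phrased through countably many of them. It
      -- does not mention `q`, so `Loses AtMostInfimum` concerns `s` alone.
      AtMostInfimum : ℝ → Pred (Point S) 0ℓ
      AtMostInfimum x s = ∀ k → LosesAt (dense k) s → x ≤ dense k

      Threshold : Pred (Point S × Interval) 0ℓ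
      Threshold (s , q) = (∃[ k ] dense k ≤ proj₁ q × LosesAt (dense k) s) ⊎
        ((∀ k → proj₁ q < dense k → LosesAt (dense k) s) × Loses AtMostInfimum s)

      -- In the second case all dense values above `q` lose, so the infimum is at most `q` and so
      -- are the partial sums.
      threshold⇒losesAt : ∀ s q → Threshold (s , q) → LosesAt (proj₁ q) s
      threshold⇒losesAt s q (inj₁ (k , d≤q , l)) = loses-mono {AtMost (dense k)} {AtMost (proj₁ q)} (λ x x≤d → ≤.trans x≤d d≤q) l
      threshold⇒losesAt s q (inj₂ (above , l)) = loses-mono {AtMostInfimum} {AtMost (proj₁ q)}
        (λ x b → ≮⇒≥ λ q<x → let k , q<d , d<x = dense-between q<x in <⇒≱ d<x (b k (above k q<d))) l

      -- If no dense value up to `q` loses, `q` lies below every losing one, and sums bounded by `q`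
      -- are bounded by the infimum.
      losesAt⇒threshold : ∀ s q → LosesAt (proj₁ q) s → Threshold (s , q)
      losesAt⇒threshold s q l with em {P = ∃[ k ] dense k ≤ proj₁ q × LosesAt (dense k) s}
      ... | yes h = inj₁ h
      ... | no ¬h = inj₂ ((λ k q<d → loses-mono {AtMost (proj₁ q)} {AtMost (dense k)} (λ x x≤q → ≤.trans x≤q (proj₁ q<d)) l) ,
        loses-mono {AtMost (proj₁ q)} {AtMostInfimum} (λ x x≤q k l′ → ≤.trans x≤q (proj₁ (≰⇒> (λ d≤q → ¬h (k , d≤q , l′))))) l)

      threshold-measurable : Meas S×I Threshold
      threshold-measurable = meas-⊎ S×I
        (meas-∃ S×I λ k → meas-× S×I (above-measurable (dense k)) (meas-proj₁ S I (losesAt-measurable (dense k))))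
        (meas-× S×I
          (meas-∀ S×I λ k → meas-resp S×I
            {P = λ (s , q) → dense k ≤ proj₁ q ⊎ LosesAt (dense k) s} {Q = λ (s , q) → proj₁ q < dense k → LosesAt (dense k) s}
            (λ { _ (inj₁ d≤q) q<d → ⊥-elim (<⇒≱ q<d d≤q) ; _ (inj₂ l) _ → l })
            (λ (s , q) h → [ inj₂ ∘ h , inj₁ ]′ (<∨≥ (proj₁ q) (dense k)))
            (meas-⊎ S×I (above-measurable (dense k)) (meas-proj₁ S I (losesAt-measurable (dense k)))))
          -- A second use of the Souslin operation, with a bound depending on `s` through the sets
          -- that its first use made measurable.
          (meas-proj₁ S I (loses-measurable AtMostInfimum λ x →
            meas-∀ S λ k → meas-resp S
              {P = λ s → ¬ LosesAt (dense k) s ⊎ x ≤ dense k} {Q = λ s → LosesAt (dense k) s → x ≤ dense k}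
              (λ { _ (inj₁ ¬l) l → ⊥-elim (¬l l) ; _ (inj₂ b) _ → b })
              (λ s h → [ (λ x>d → inj₁ (λ l → <⇒≱ x>d (h l))) , inj₂ ]′ (<∨≥ (dense k) x))
              (meas-⊎ S (meas-¬ S (losesAt-measurable (dense k))) (meas-const S (x ≤ dense k))))))
        where
        above-measurable : ∀ r → Meas S×I (λ (s , q) → r ≤ proj₁ q)
        above-measurable r = meas-resp S×I {P = λ (s , q) → ¬ (proj₁ q < r)} {Q = λ (s , q) → r ≤ proj₁ q}
          (λ _ → ≮⇒≥) (λ _ r≤q q<r → <⇒≱ q<r r≤q) (meas-¬ S×I (meas-proj₂ S I (below-measurable r)))

      Wins : Pred (Point S × Interval) 0ℓ
      Wins (s , q) = ∀ a → Q^∞ (proj₁ q) a → ∃[ n ] s ∈ f n A (fromℚ (a n))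

      wins⇒¬losesAt : ∀ s q → Wins (s , q) → ¬ LosesAt (proj₁ q) s
      wins⇒¬losesAt s q win (α , l) =
        let n , t = win (enumℚ ∘ α) ((λ i → proj₁ (proj₁ (l i))) , λ n → proj₁ (proj₂ (l n))) in proj₂ (proj₂ (l n)) t

      -- Each term of a sequence in `Q^∞ q` is below a partial sum, hence at most 1, so the
      -- restriction built into `Losing` discards none of the relevant sequences.
      ¬losesAt⇒wins : ∀ s q → ¬ LosesAt (proj₁ q) s → Wins (s , q)
      ¬losesAt⇒wins s (q , 0≤q , q≤1) ¬l a (0≤a , ∑≤q) with em {P = ∃[ n ] s ∈ f n A (fromℚ (a n))}
      ... | yes h = h
      ... | no ¬h = ⊥-elim (¬l (code , λ n →
        subst (λ p → 0ℚ ℚ.≤ p × fromℚ p ≤ 1#) (sym (decode n))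
          (0≤a n , ≤.trans (term≤∑ n (fromℚ ∘ a) (λ i → fromℚ-nonneg (a i) (0≤a i))) (≤.trans (∑≤q (suc n)) q≤1)) ,
        subst (_≤ q) (sum-cong-≗ {n} (λ i → cong fromℚ (sym (decode (toℕ i))))) (∑≤q n) ,
        subst (λ p → ¬ (s ∈ f n A (fromℚ p))) (sym (decode n)) (λ t → ¬h (n , t))))
        where
        code : ℕ → ℕ
        code n = proj₁ (enumℚ-surjective (a n))
        decode : ∀ n → enumℚ (code n) ≡ a n
        decode n = proj₂ (enumℚ-surjective (a n))

      wins-measurable : Meas S×I Wins
      wins-measurable = meas-resp S×I {P = λ (s , q) → ¬ Threshold (s , q)} {Q = Wins}
        (λ (s , q) ¬t → ¬losesAt⇒wins s q (λ l → ¬t (losesAt⇒threshold s q l)))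
        (λ (s , q) win t → wins⇒¬losesAt s q win (threshold⇒losesAt s q t))
        (meas-¬ S×I threshold-measurable)

    joint-angelic : ∀ {F f} → (∀ {f} → JointlyMeasurable f → JointlyMeasurable (F f)) →
      JointlyMeasurable f → JointlyMeasurable (angelic F f)
    joint-angelic {F} {f} JF J A = Angelic.wins-measurable (λ n → iterate F n f) (λ n → joint-iterate JF n J) A

    -- Keeping the continuation `f` arbitrary turns composition into two appeals to the induction
    -- hypothesis, and makes `τ ▷_` an operator whose iterates preserve the invariant.
    joint-▷ : ∀ τ {f} → JointlyMeasurable f → JointlyMeasurable (τ ▷ f)
    joint-▷ (prim γ) {f} J = joint-after γ {f} J
    joint-▷ (τ ᵈ) {f} J    = joint-dual {τ ▷ dual f} (joint-▷ τ (joint-dual {f} J))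
    joint-▷ (σ ∪ᵍ τ) {f} J = joint-choice {σ ▷ f} {τ ▷ f} (joint-▷ σ J) (joint-▷ τ J)
    joint-▷ (σ ∩ᵍ τ) {f} J = joint-dual {choice (dual (σ ▷ f)) (dual (τ ▷ f))} (joint-choice {dual (σ ▷ f)} {dual (τ ▷ f)}
      (joint-dual {σ ▷ f} (joint-▷ σ J)) (joint-dual {τ ▷ f} (joint-▷ τ J)))
    joint-▷ (σ ⨾ τ) J  = joint-▷ σ (joint-▷ τ J)
    joint-▷ (τ ✶) {f} J    = joint-angelic {τ ▷_} {f} (joint-▷ τ) J
    joint-▷ (τ ✕) {f} J    = joint-dual {angelic (λ h → dual (τ ▷ dual h)) (dual f)}
      (joint-angelic {λ h → dual (τ ▷ dual h)} {dual f}
        (λ {h} J → joint-dual {τ ▷ dual h} (joint-▷ τ (joint-dual {h} J))) (joint-dual {f} J))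

    joint-𝔍 : ∀ τ → JointlyMeasurable (𝔍 τ)
    joint-𝔍 (prim γ) = joint-atomic γ
    joint-𝔍 (τ ᵈ)    = joint-dual {𝔍 τ} (joint-𝔍 τ)
    joint-𝔍 (σ ∪ᵍ τ) = joint-choice {𝔍 σ} {𝔍 τ} (joint-𝔍 σ) (joint-𝔍 τ)
    joint-𝔍 (σ ∩ᵍ τ) = joint-dual {choice (dual (𝔍 σ)) (dual (𝔍 τ))} (joint-choice {dual (𝔍 σ)} {dual (𝔍 τ)}
      (joint-dual {𝔍 σ} (joint-𝔍 σ)) (joint-dual {𝔍 τ} (joint-𝔍 τ)))
    joint-𝔍 (σ ⨾ τ)  = joint-▷ σ (joint-𝔍 τ)
    joint-𝔍 (τ ✶)    = joint-▷ (τ ✶) (joint-atomic ε)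
    joint-𝔍 (τ ✕)    = joint-dual {(τ ᵈ) ✶ ▷ atomic ε} (joint-▷ ((τ ᵈ) ✶) (joint-atomic ε))

proposition5p5 :
  (em : {a : Level} → ExcludedMiddle a) (R : CompleteOrderedField) →
  let open CompleteOrderedField R
      open Theory em R in
  (Λ : SubProb unitInterval) → IsLebesgue Λ →
  {g ℓ : Level} {Γ : Set g} {ε : Γ} (𝒢 : GameFrame Γ ε ℓ) →
  let open GameFrame 𝒢
      open Interpretation Λ 𝒢 in
  SouslinClosed S →
  (τ : Game Γ) (A : Event S) (q : ℝ) → 0# ≤ q → q ≤ 1# →
  Measurable S (𝔍 τ A q)
proposition5p5 em R Λ _ 𝒢 closed τ = joint-section {𝔍 τ} (joint-𝔍 closed τ)
  where
  open Theory.Interpretation em R Λ 𝒢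
  open Interpretations em R Λ 𝒢
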